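{- For every positive integer $n$, let $T(n)$ denote the maximum number of transversals in a Latin square of order $n$. Then \[ T(n) \geq \left((1-o(1))\frac{n}{e^2}\right)^{n}, \] where $o(1)$ denotes a quantity tending to $0$ as $n\to\infty$.
   Context: A Latin square of order $n$ is an $n\times n$ matrix with entries from an alphabet of $n$ symbols in which every symbol appears exactly once in every row and every column. A transversal of a Latin square of order $n$ is a set of $n$ entries containing exactly one entry from each row, exactly one from each column, and exactly one of each symbol. -}

module Defs where

open import Data.Nat using (ℕ; zero; suc)
open import Data.Fin using (Fin)
open import Data.Integer using (+_)
open import Data.Rational using (ℚ; _/_; _*_; _+_; 1ℚ; 0ℚ)
open import Data.Product using (Σ; _×_)
open import Function.Definitions using (Injective)
open import Relation.Binary.PropositionalEquality using (_≡_; _≗_)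

ℕ→ℚ : ℕ → ℚ
ℕ→ℚ n = + n / 1

infixr 8 _^ℚ_
_^ℚ_ : ℚ → ℕ → ℚ
q ^ℚ zero  = 1ℚ
q ^ℚ suc k = q * (q ^ℚ k)

-- j-th term of the exponential series for e², i.e. 2^j / j!
e²-term : ℕ → ℚ
e²-term zero    = 1ℚ
e²-term (suc j) = e²-term j * (+ 2 / suc j)

-- partial sum  Σ_{j=0}^{k} 2^j / j!   (increasing, with limit e²)
e²-partial : ℕ → ℚ
e²-partial zero    = e²-term zero
e²-partial (suc k) = e²-partial k + e²-term (suc k)

-- A Latin square of order n over the alphabet Fin n:
-- every symbol appears exactly once in each row and column
-- (for a map Fin n → Fin n, injective ⇔ bijective).
IsLatinSquare : (n : ℕ) → (Fin n → Fin n → Fin n) → Set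
IsLatinSquare n L =
  ((i : Fin n) → Injective _≡_ _≡_ (λ j → L i j)) × ((j : Fin n) → Injective _≡_ _≡_ (λ i → L i j))

-- A transversal, described by the column σ i chosen in row i
-- (so the cells are {(i , σ i)}): exactly one cell per row by construction,
-- distinct columns, and distinct symbols.
IsTransversal : (n : ℕ) → (Fin n → Fin n → Fin n) → (Fin n → Fin n) → Set
IsTransversal n L σ =
  Injective _≡_ _≡_ σ × Injective _≡_ _≡_ (λ i → L i (σ i))

HasAtLeastTransversals : (n : ℕ) → (Fin n → Fin n → Fin n) → ℕ → Set
HasAtLeastTransversals n L m =
  Σ (Fin m → (Fin n → Fin n)) λ f →
    ((k : Fin m) → IsTransversal n L (f k)) ×
    (∀ {a b} → f a ≗ f b → a ≡ b)

{-# OPTIONS --safe #-}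
-- Take n = km + r with k = s + 2, m = st, s a large constant and t → ∞, and build a Latin square of order n
-- from a cyclic square of order k by replacing its cells with blocks of order m (r extra rows, columns and
-- symbols are added by prolonging along a transversal of the cyclic square). The blocks on s of the
-- remaining diagonals are arbitrary isotopes of the cyclic square of order m. Consider placements that use t
-- cells of each of these blocks, once per row, column and symbol: distributing rows over the blocks by
-- balanced words and ordering columns and symbols by permutations gives s^(km) (m!)^(2k) of them up to
-- factors polynomial in t. For a random isotope the t prescribed cells of a block carry the prescribed
-- symbols with probability at least ((1 - 2/s)/m)^t, by choosing images greedily. Fixing the isotopes one
-- block at a time so that the average is attained leaves ((1 - O(1/s)) n/e²)^n placements that are
-- transversals of one square.
--
-- Two facts make this effective. Since (1 + 2/N)^N ≤ Σ_{j≤N} 2^j/j!, any p/q below 1/e² satisfies (p m²/q)^m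
-- ≤ (m!)². And a rational P/Q bounded by 1/e² is bounded away from it: for N a power of 2 the numbers N! and
-- N! Σ_{j≤N} 2^j/j! are divisible by 2^(N-1), while N! times the tail is O(2^N/N).
module Submission where

open import Defs
open import Data.Nat using (ℕ; zero; suc; _≥_)
open import Data.Fin using (Fin)
open import Data.Product using (Σ; ∃; _×_; _,_)
open import Relation.Binary.PropositionalEquality

-- A placement prescribes cells and symbols before any square is chosen, so the bound for one block
-- holds whatever was decided for the others, and averaging can proceed block by block. Using only t
-- of the m rows of a block keeps the greedy step cheap: at most 2t of the m = st images are ever
-- excluded. Columns and symbols contribute one factor 1/e each. The cyclic pairs used below need
-- odd order. So s, k and m are odd, which forces t to be odd and explains why k exceeds s by 2
-- although a single diagonal is prolonged. Admissible values of km then lie 2ks apart, and r has to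
-- cover all residues; it starts at 4, as the extra rows need a Latin square of order r with a
-- transversal and order 2 has none. The hypothesis only says that c is at most 1/e², while each
-- fixed s loses a constant factor. This is where the irrationality of e² enters, in a quantitative
-- form: the size of the gap decides how large s must be.

module LatinSquares where
  open import Data.Nat as ℕ using (ℕ; zero; suc; _+_; _*_; _^_; _≤_; _<_; z≤n; s≤s; _!; NonZero)
  open import Data.Nat.Properties hiding (suc-injective; _≟_)
  open import Data.Nat.DivMod using (_%_; _/_; m%n<n; m≡m%n+[m/n]*n; [m+kn]%n≡m%n; m<n⇒m%n≡m)
  open import Data.Nat.Tactic.RingSolver using (solve-∀)
  open import Data.Bool using (if_then_else_)
  open import Data.Fin using (zero; suc; toℕ; fromℕ<; inject≤; cast; punchIn; punchOut; combine; remQuot; splitAt; _↑ˡ_; _↑ʳ_; finToFun; funToFin)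
  open import Data.Fin.Properties
    using ( _≟_; any?; all?; suc-injective; injective⇒≤; toℕ-injective; toℕ<n; fromℕ<-injective; toℕ-fromℕ<
          ; inject≤-injective; toℕ-inject≤; toℕ-cast; punchIn-injective; punchOut-injective; punchIn-punchOut; punchInᵢ≢i
          ; splitAt-↑ˡ; splitAt-↑ʳ; +↔⊎; *↔×; remQuot-combine; combine-remQuot; combine-injectiveˡ; combine-injectiveʳ
          ; finToFun-funToFin; funToFin-finToFin)
  open import Data.Fin.Permutation as Perm
    using (Permutation′; _⟨$⟩ʳ_; _⟨$⟩ˡ_; insert; remove; insert-remove; insert-punchIn; permutation; _≈_)
  open import Data.Product using (proj₁; proj₂; uncurry)
  open import Data.Product.Properties using (,-injectiveˡ; ,-injectiveʳ)
  open import Data.Sum using (_⊎_; inj₁; inj₂; [_,_]′)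
  open import Data.Sum.Properties using (inj₁-injective; inj₂-injective)
  open import Data.Sum.Function.Propositional using (_⊎-↔_)
  open import Function using (_∘_; _↔_; Inverse; _⇔_; mk⇔)
  open import Function.Construct.Composition using (_↔-∘_)
  open import Function.Construct.Identity using (↔-id)
  open import Function.Definitions using (Injective)
  open import Relation.Nullary using (Dec; yes; no; does; contradiction)
  open import Relation.Nullary.Decidable using (does-⇔)
  open import Relation.Unary using (Pred; Decidable)
  open import Level using (0ℓ)
  open import Algebra.Properties.CommutativeMonoid.Sum +-0-commutativeMonoid using (sum; ∑-comm; sum-cong-≗; sum-permute)

  -- Counting over finite types and averaging

  Inj : {A B : Set} → (A → B) → Set
  Inj f = Injective _≡_ _≡_ f

  ^-distribʳ-* : ∀ n a b → (a * b) ^ n ≡ a ^ n * b ^ n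
  ^-distribʳ-* zero    a b = refl
  ^-distribʳ-* (suc n) a b =
    trans (cong (a * b *_) (^-distribʳ-* n a b)) ([m*n]*[o*p]≡[m*o]*[n*p] a b (a ^ n) (b ^ n))

  sum-const : ∀ n c → sum {n} (λ _ → c) ≡ n * c
  sum-const zero    c = refl
  sum-const (suc n) c = cong (c +_) (sum-const n c)

  sum-mono-≤ : ∀ {n} {f g : Fin n → ℕ} → (∀ i → f i ≤ g i) → sum f ≤ sum g
  sum-mono-≤ {zero}  f≤g = z≤n
  sum-mono-≤ {suc n} f≤g = +-mono-≤ (f≤g zero) (sum-mono-≤ (f≤g ∘ suc))

  sum-≤-max : ∀ n .{{_ : NonZero n}} (f : Fin n → ℕ) → ∃ λ j → sum f ≤ n * f j
  sum-≤-max (suc zero)    f = zero , ≤-refl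
  sum-≤-max (suc (suc n)) f with sum-≤-max (suc n) (f ∘ suc)
  ... | j , s≤ with ≤-total (f zero) (f (suc j))
  ...   | inj₁ f₀≤ = suc j , +-mono-≤ f₀≤ s≤
  ...   | inj₂ ≤f₀ = zero , +-monoʳ-≤ (f zero) (≤-trans s≤ (*-monoʳ-≤ (suc n) ≤f₀))

  [_]₀₁ : {P : Set} → Dec P → ℕ
  [ p ]₀₁ = if does p then 1 else 0

  # : ∀ {n} {P : Pred (Fin n) 0ℓ} → Decidable P → ℕ
  # P? = sum (λ i → [ P? i ]₀₁)

  opaque
    enumerate : ∀ {n} {P : Pred (Fin n) 0ℓ} (P? : Decidable P) →
                Σ (Fin (# P?) → Fin n) λ f → Inj f × (∀ j → P (f j))
    enumerate {zero}  P? = (λ ()) , (λ {}) , λ ()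
    enumerate {suc n} {P} P? with P? zero | enumerate (P? ∘ suc)
    ... | no _  | f , f-inj , fP = suc ∘ f , f-inj ∘ suc-injective , fP
    ... | yes p | f , f-inj , fP = f′ , (λ {i} {j} → f′-inj i j) , f′P
      where
      f′ : Fin (suc (# (P? ∘ suc))) → Fin (suc n)
      f′ zero    = zero
      f′ (suc j) = suc (f j)
      f′-inj : ∀ i j → f′ i ≡ f′ j → i ≡ j
      f′-inj zero    zero    _  = refl
      f′-inj (suc i) (suc j) eq = cong suc (f-inj (suc-injective eq))
      f′P : ∀ (j : Fin (suc (# (P? ∘ suc)))) → P (f′ j)
      f′P zero    = p
      f′P (suc j) = fP j

    -- Counterpart of `enumerate`: there a count yields elements, here the elements are numbered,
    -- which turns an injective family of examples into a lower bound for the count.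
    rank : ∀ {n} {P : Pred (Fin n) 0ℓ} (P? : Decidable P) →
           Σ (∀ i → P i → Fin (# P?)) λ g → ∀ i j p q → g i p ≡ g j q → i ≡ j
    rank {zero}  P? = (λ ()) , λ ()
    rank {suc n} {P} P? with P? zero | rank (P? ∘ suc)
    ... | no ¬p | g , g-inj = g′ , g′-inj
      where
      g′ : ∀ i → P i → Fin (# (P? ∘ suc))
      g′ zero    p = contradiction p ¬p
      g′ (suc i) p = g i p
      g′-inj : ∀ i j p q → g′ i p ≡ g′ j q → i ≡ j
      g′-inj zero    _       p _ _  = contradiction p ¬p
      g′-inj (suc _) zero    _ q _  = contradiction q ¬p
      g′-inj (suc i) (suc j) p q eq = cong suc (g-inj i j p q eq)
    ... | yes _ | g , g-inj = g′ , g′-inj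
      where
      g′ : ∀ i → P i → Fin (suc (# (P? ∘ suc)))
      g′ zero    p = zero
      g′ (suc i) p = suc (g i p)
      g′-inj : ∀ i j p q → g′ i p ≡ g′ j q → i ≡ j
      g′-inj zero    zero    p q eq = refl
      g′-inj (suc i) (suc j) p q eq = cong suc (g-inj i j p q (suc-injective eq))

  ≤-# : ∀ {n q} {P : Pred (Fin n) 0ℓ} (P? : Decidable P) (f : Fin q → Fin n) →
        Inj f → (∀ j → P (f j)) → q ≤ # P?
  ≤-# P? f f-inj fP with rank P?
  ... | g , g-inj = injective⇒≤ {f = λ j → g (f j) (fP j)} (λ eq → f-inj (g-inj _ _ _ _ eq))

  opaque
    -- Double counting of the pairs (x, ω) satisfying P; the best ω does at least as well as the
    -- average.
    popular : ∀ {A M q} .{{_ : NonZero M}} {P : Fin A → Fin M → Set} (P? : ∀ x ω → Dec (P x ω)) →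
              (∀ x → q ≤ # (P? x)) → ∃ λ ω → A * q ≤ M * # (λ x → P? x ω)
    popular {A} {M} {q} P? q≤ with sum-≤-max M (λ ω → # (λ x → P? x ω))
    ... | ω , ≤# = ω , (begin
      A * q                                  ≡⟨ sum-const A q ⟨
      sum {A} (λ _ → q)                      ≤⟨ sum-mono-≤ q≤ ⟩
      sum (λ x → # (P? x))                   ≡⟨ ∑-comm (λ x ω → [ P? x ω ]₀₁) ⟩
      sum (λ ω → # (λ x → P? x ω))           ≤⟨ ≤# ⟩
      M * # (λ x → P? x ω)               ∎)
      where open ≤-Reasoning

    -- The lower bound q is assumed for every x, so it survives restriction to the x kept by other
    -- choices. Each round re-enumerates the survivors and keeps at least the proportion q / M of
    -- them.
    popular-choices : ∀ {A M q} .{{_ : NonZero M}} B {P : Fin B → Fin A → Fin M → Set} (P? : ∀ b x ω → Dec (P b x ω)) →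
      (∀ b x → q ≤ # (P? b x)) →
      Σ (Fin B → Fin M) λ ω → Σ ℕ λ A′ → Σ (Fin A′ → Fin A) λ g →
        Inj g × (∀ b j → P b (g j) (ω b)) × A * q ^ B ≤ M ^ B * A′
    popular-choices {A} zero P? q≤ =
      (λ ()) , A , (λ x → x) , (λ eq → eq) , (λ ()) , ≤-reflexive (*-comm A 1)
    popular-choices {A} {M} {q} (suc B) P? q≤
      with popular-choices B (P? ∘ suc) (q≤ ∘ suc)
    ... | ω , A′ , g , g-inj , gP , ≤A′
      with popular (λ x → P? zero (g x)) (λ x → q≤ zero (g x))
    ... | ω₀ , ≤#
      with enumerate (λ x → P? zero (g x) ω₀)
    ... | h , h-inj , hP =
      (λ { zero → ω₀ ; (suc b) → ω b }) , _ , g ∘ h , h-inj ∘ g-inj ,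
      (λ { zero j → hP j ; (suc b) j → gP b (h j) }) , chain ≤A′ ≤#
      where
      chain : ∀ {A′ A″} → A * q ^ B ≤ M ^ B * A′ → A′ * q ≤ M * A″ →
              A * q ^ suc B ≤ M ^ suc B * A″
      chain {A′} {A″} ≤A′ ≤A″ = begin
        A * (q * q ^ B)                  ≡⟨ cong (A *_) (*-comm q (q ^ B)) ⟩
        A * (q ^ B * q)                  ≡⟨ *-assoc A (q ^ B) q ⟨
        A * q ^ B * q                    ≤⟨ *-monoˡ-≤ q ≤A′ ⟩
        M ^ B * A′ * q               ≡⟨ *-assoc (M ^ B) A′ q ⟩
        M ^ B * (A′ * q)             ≤⟨ *-monoʳ-≤ (M ^ B) ≤A″ ⟩
        M ^ B * (M * A″)         ≡⟨ *-assoc (M ^ B) (M) A″ ⟨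
        M ^ B * M * A″           ≡⟨ cong (_* A″) (*-comm (M ^ B) (M)) ⟩
        M * M ^ B * A″           ∎
        where open ≤-Reasoning

  -- Permutations: codes and completions of partial permutations

  opaque
    injective⇒surjective : ∀ {n} {f : Fin n → Fin n} → Inj f → ∀ y → ∃ λ x → f x ≡ y
    injective⇒surjective {suc n} {f} f-inj y with any? (λ x → f x ≟ y)
    ... | yes hit = hit
    ... | no  ¬hit = contradiction (injective⇒≤ {f = λ x → punchOut (y≢f x)}
                                      (f-inj ∘ punchOut-injective (y≢f _) (y≢f _))) (<⇒≱ ≤-refl)
      where
      y≢f : ∀ x → y ≢ f x
      y≢f x eq = ¬hit (x , sym eq)

  injective⇒permutation : ∀ {n} (f : Fin n → Fin n) → Inj f → Permutation′ n
  injective⇒permutation f f-inj = permutation f (proj₁ ∘ surj) (proj₂ ∘ surj) (λ x → f-inj (proj₂ (surj (f x))))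
    where surj = injective⇒surjective f-inj

  ⟨$⟩ʳ-injective : ∀ {n} (π : Permutation′ n) → Inj (π ⟨$⟩ʳ_)
  ⟨$⟩ʳ-injective π {i} {j} eq = trans (sym (Perm.inverseˡ π)) (trans (cong (π ⟨$⟩ˡ_) eq) (Perm.inverseˡ π))

  ⟨$⟩ˡ-injective : ∀ {n} (π : Permutation′ n) → Inj (π ⟨$⟩ˡ_)
  ⟨$⟩ˡ-injective π {i} {j} eq = trans (sym (Perm.inverseʳ π)) (trans (cong (π ⟨$⟩ʳ_) eq) (Perm.inverseʳ π))

  insert-at : ∀ {m} i j (π : Permutation′ m) → insert i j π ⟨$⟩ʳ i ≡ j
  insert-at i j π with i ≟ i
  ... | yes _  = refl
  ... | no i≢i = contradiction refl i≢i

  insert-injective : ∀ {m} i {j j′} {π π′ : Permutation′ m} →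
                     insert i j π ≈ insert i j′ π′ → j ≡ j′ × π ≈ π′
  insert-injective i {j} {j′} {π} {π′} eq = j≡j′ , λ k →
    punchIn-injective j _ _ (begin
      punchIn j (π ⟨$⟩ʳ k)                 ≡⟨ insert-punchIn i j π k ⟨
      insert i j π ⟨$⟩ʳ punchIn i k        ≡⟨ eq (punchIn i k) ⟩
      insert i j′ π′ ⟨$⟩ʳ punchIn i k      ≡⟨ insert-punchIn i j′ π′ k ⟩
      punchIn j′ (π′ ⟨$⟩ʳ k)               ≡⟨ cong (λ l → punchIn l (π′ ⟨$⟩ʳ k)) j≡j′ ⟨
      punchIn j (π′ ⟨$⟩ʳ k)                ∎)
    where
    open ≡-Reasoning
    j≡j′ : j ≡ j′
    j≡j′ = trans (sym (insert-at i j π)) (trans (eq i) (insert-at i j′ π′))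

  insert-cong : ∀ {m} i j {π π′ : Permutation′ m} → π ≈ π′ → insert i j π ≈ insert i j π′
  insert-cong i j eq k with i ≟ k
  ... | yes _ = refl
  ... | no  _ = cong (punchIn j) (eq _)

  remQuot-injective : ∀ {a} b → Inj (remQuot {a} b)
  remQuot-injective {a} b {i} {j} eq =
    trans (sym (combine-remQuot {a} b i)) (trans (cong (uncurry combine) eq) (combine-remQuot {a} b j))

  -- Factorial number system: the leading digit is the image of `zero`, the rest codes the
  -- permutation of what remains. Averaging needs permutations indexed by a finite type; they are
  -- compared pointwise, by `_≈_`.
  perm : ∀ m → Fin (m !) → Permutation′ m
  perm zero    _ = Perm.id
  perm (suc m) c = insert zero (proj₁ p) (perm m (proj₂ p))
    where p = remQuot {suc m} (m !) c

  perm-combine : ∀ m j c → perm (suc m) (combine j c) ≡ insert zero j (perm m c)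
  perm-combine m j c = cong (λ p → insert zero (proj₁ p) (perm m (proj₂ p))) (remQuot-combine j c)

  code : ∀ {m} → Permutation′ m → Fin (m !)
  code {zero}  _ = zero
  code {suc m} π = combine (π ⟨$⟩ʳ zero) (code (remove zero π))

  perm-code : ∀ {m} (π : Permutation′ m) → perm m (code π) ≈ π
  perm-code {suc m} π k = begin
    perm (suc m) (code π) ⟨$⟩ʳ k                                 ≡⟨ cong (_⟨$⟩ʳ k) (perm-combine m (π ⟨$⟩ʳ zero) _) ⟩
    insert zero (π ⟨$⟩ʳ zero) (perm m (code (remove zero π))) ⟨$⟩ʳ k
      ≡⟨ insert-cong zero _ {perm m (code (remove zero π))} {remove zero π} (perm-code (remove zero π)) k ⟩
    insert zero (π ⟨$⟩ʳ zero) (remove zero π) ⟨$⟩ʳ k             ≡⟨ insert-remove zero π k ⟩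
    π ⟨$⟩ʳ k                                                     ∎
    where open ≡-Reasoning

  perm-injective : ∀ m {c c′} → perm m c ≈ perm m c′ → c ≡ c′
  perm-injective zero    {zero} {zero} _ = refl
  perm-injective (suc m) {c} {c′} eq with insert-injective zero {π = perm m _} {perm m _} eq
  ... | j≡ , π≈ = remQuot-injective (m !) (cong₂ _,_ j≡ (perm-injective m π≈))

  module _ {t m : ℕ} (c : Fin (suc t) → Fin (suc m)) (c-inj : Inj c) where

    tail≢head : ∀ i → c zero ≢ c (suc i)
    tail≢head i eq with () ← c-inj eq

    drop-head : Fin t → Fin m
    drop-head i = punchOut (tail≢head i)

    drop-head-injective : Inj drop-head
    drop-head-injective eq = suc-injective (c-inj (punchOut-injective (tail≢head _) (tail≢head _) eq))

  -- The completions of the partial injection c i ↦ b i. Each pair is removed by renumbering the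
  -- other points, so that after t pairs a permutation of m free points is left, and `x` names it.
  extension : ∀ t {m} (c b : Fin t → Fin (t + m)) → Inj c → Inj b → Fin (m !) → Permutation′ (t + m)
  extension zero    c b c-inj b-inj x = perm _ x
  extension (suc t) c b c-inj b-inj x = insert (c zero) (b zero)
    (extension t (drop-head c c-inj) (drop-head b b-inj) (drop-head-injective c c-inj) (drop-head-injective b b-inj) x)

  extension-extends : ∀ t {m} c b (c-inj : Inj c) (b-inj : Inj b) x i → extension t {m} c b c-inj b-inj x ⟨$⟩ʳ c i ≡ b i
  extension-extends (suc t) c b c-inj b-inj x zero    = insert-at (c zero) (b zero) _
  extension-extends (suc t) c b c-inj b-inj x (suc i) = begin
    insert (c zero) (b zero) π ⟨$⟩ʳ c (suc i)                 ≡⟨ cong (insert (c zero) (b zero) π ⟨$⟩ʳ_) (punchIn-punchOut (tail≢head c c-inj i)) ⟨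
    insert (c zero) (b zero) π ⟨$⟩ʳ punchIn (c zero) (c′ i)   ≡⟨ insert-punchIn (c zero) (b zero) π (c′ i) ⟩
    punchIn (b zero) (π ⟨$⟩ʳ c′ i)                            ≡⟨ cong (punchIn (b zero)) (extension-extends t c′ b′ _ _ x i) ⟩
    punchIn (b zero) (b′ i)                                   ≡⟨ punchIn-punchOut (tail≢head b b-inj i) ⟩
    b (suc i)                                                 ∎
    where
    open ≡-Reasoning
    c′ = drop-head c c-inj
    b′ = drop-head b b-inj
    π = extension t c′ b′ (drop-head-injective c c-inj) (drop-head-injective b b-inj) x

  extension-injective : ∀ t {m} c b (c-inj : Inj c) (b-inj : Inj b) {x y} →
    extension t {m} c b c-inj b-inj x ≈ extension t c b c-inj b-inj y → x ≡ y
  extension-injective zero    c b c-inj b-inj eq = perm-injective _ eq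
  extension-injective (suc t) c b c-inj b-inj eq =
    extension-injective t _ _ _ _ (proj₂ (insert-injective (c zero) {π = extension t _ _ _ _ _} {extension t _ _ _ _ _} eq))

  -- Greedy choice of images and the number of suitable isotopes

  avoiding : ∀ u {g m} (F : Fin u → Fin m) → u + g ≤ m →
             Σ (Fin g → Fin m) λ e → Inj e × (∀ j i → e j ≢ F i)
  avoiding zero            F g≤m = (λ j → inject≤ j g≤m) , (λ eq → inject≤-injective g≤m g≤m _ _ eq) , λ _ ()
  avoiding (suc u) {zero}  F u≤m = (λ ()) , (λ {}) , λ ()
  avoiding (suc u) {suc g} {suc zero} F (s≤s u+g≤0) =
    contradiction (≤-trans (m≤n+m (suc g) u) u+g≤0) λ ()
  avoiding (suc u) {suc g} {suc (suc m)} F (s≤s u+g≤m) = extend (avoiding u F′ u+g≤m)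
    where
    F₀ = F zero
    F′ : Fin u → Fin (suc m)
    F′ i with F₀ ≟ F (suc i)
    -- A repetition of the first forbidden value is already excluded by `punchIn F₀`, so `zero` is a
    -- mere placeholder.
    ... | yes _ = zero
    ... | no F₀≢ = punchOut F₀≢
    extend : (Σ (Fin (suc g) → Fin (suc m)) λ e → Inj e × (∀ j i → e j ≢ F′ i)) →
             Σ (Fin (suc g) → Fin (suc (suc m))) λ e → Inj e × (∀ j i → e j ≢ F i)
    extend (e , e-inj , e≢F′) = punchIn F₀ ∘ e , (λ eq → e-inj (punchIn-injective F₀ _ _ eq)) , avoids
      where
      avoids : ∀ j i → punchIn F₀ (e j) ≢ F i
      avoids j zero    eq = punchInᵢ≢i F₀ (e j) eq
      avoids j (suc i) eq with F₀ ≟ F (suc i) | e≢F′ j i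
      ... | yes F₀≡ | _   = punchInᵢ≢i F₀ (e j) (trans eq (sym F₀≡))
      ... | no F₀≢ | e≢ = e≢ (punchIn-injective F₀ _ _ (trans eq (sym (punchIn-punchOut F₀≢))))

  module Greedy {m g : ℕ} (M Mr : Fin m → Fin m → Fin m) (M-Mr : ∀ x z → M x (Mr x z) ≡ z)
                (M-row : ∀ x → Inj (M x)) where

    record Choices {t : ℕ} (r : Fin t → Fin m) : Set where
      field
        choice     : Fin (g ^ t) → Fin t → Fin m
        choice-inj : ∀ γ → Inj (choice γ)
        symbol-inj : ∀ γ → Inj (λ i → M (r i) (choice γ i))
        distinct   : ∀ γ γ′ → choice γ ≗ choice γ′ → γ ≡ γ′

    greedy : ∀ t (r : Fin t → Fin m) → (t + t) + g ≤ m → Choices r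
    greedy zero r _ = record
      { choice = λ _ () ; choice-inj = λ _ {} ; symbol-inj = λ _ {} ; distinct = λ { zero zero _ → refl } }
    greedy (suc t) r 2t+g≤m = record
      { choice = choice′ ; choice-inj = inj₁′ ; symbol-inj = inj₂′ ; distinct = distinct′ }
      where
      2t+g≤m′ : (t + t) + g ≤ m
      2t+g≤m′ = ≤-trans (+-monoˡ-≤ g (+-mono-≤ (n≤1+n t) (n≤1+n t))) 2t+g≤m
      open Choices (greedy t (r ∘ suc) 2t+g≤m′)
      -- The first t excluded images are columns in use; the other t are the columns where row
      -- `r zero` carries a symbol in use.
      forbidden : Fin (g ^ t) → Fin (t + t) → Fin m
      forbidden γ i = [ choice γ , (λ i → Mr (r zero) (M (r (suc i)) (choice γ i))) ]′ (splitAt t i)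
      fresh : ∀ γ → Σ (Fin g → Fin m) λ e → Inj e × (∀ j i → e j ≢ forbidden γ i)
      fresh γ = avoiding (t + t) (forbidden γ) 2t+g≤m′
      fresh-choice : ∀ γ j i → proj₁ (fresh γ) j ≢ choice γ i
      fresh-choice γ j i eq = proj₂ (proj₂ (fresh γ)) j (i ↑ˡ t)
        (trans eq (cong [ _ , _ ]′ (sym (splitAt-↑ˡ t i t))))
      fresh-symbol : ∀ γ j i → M (r zero) (proj₁ (fresh γ) j) ≢ M (r (suc i)) (choice γ i)
      fresh-symbol γ j i eq = proj₂ (proj₂ (fresh γ)) j (t ↑ʳ i)
        (trans (M-row (r zero) (trans eq (sym (M-Mr _ _)))) (cong [ _ , _ ]′ (sym (splitAt-↑ʳ t t i))))
      cons : Fin g × Fin (g ^ t) → Fin (suc t) → Fin m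
      cons (j , γ) zero    = proj₁ (fresh γ) j
      cons (j , γ) (suc i) = choice γ i
      choice′ : Fin (g ^ suc t) → Fin (suc t) → Fin m
      choice′ γ = cons (remQuot (g ^ t) γ)
      cons-inj : ∀ p → Inj (cons p)
      cons-inj p       {zero}  {zero}  eq = refl
      cons-inj (j , γ) {zero}  {suc i} eq = contradiction eq (fresh-choice γ j i)
      cons-inj (j , γ) {suc i} {zero}  eq = contradiction (sym eq) (fresh-choice γ j i)
      cons-inj (j , γ) {suc i} {suc k} eq = cong suc (choice-inj γ eq)
      cons-symbol-inj : ∀ p → Inj (λ i → M (r i) (cons p i))
      cons-symbol-inj p       {zero}  {zero}  eq = refl
      cons-symbol-inj (j , γ) {zero}  {suc i} eq = contradiction eq (fresh-symbol γ j i)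
      cons-symbol-inj (j , γ) {suc i} {zero}  eq = contradiction (sym eq) (fresh-symbol γ j i)
      cons-symbol-inj (j , γ) {suc i} {suc k} eq = cong suc (symbol-inj γ eq)
      cons-distinct : ∀ p q → cons p ≗ cons q → p ≡ q
      cons-distinct (j , γ) (j′ , γ′) eq with distinct γ γ′ (eq ∘ suc)
      ... | refl = cong (_, γ) (proj₁ (proj₂ (fresh γ)) (eq zero))
      inj₁′ : ∀ γ → Inj (choice′ γ)
      inj₁′ γ = cons-inj (remQuot (g ^ t) γ)
      inj₂′ : ∀ γ → Inj (λ i → M (r i) (choice′ γ i))
      inj₂′ γ = cons-symbol-inj (remQuot (g ^ t) γ)
      distinct′ : ∀ γ γ′ → choice′ γ ≗ choice′ γ′ → γ ≡ γ′
      distinct′ γ γ′ eq = remQuot-injective (g ^ t) (cons-distinct _ _ eq)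

  module BlockCount {t m g : ℕ} (M Mr : Fin (t + m) → Fin (t + m) → Fin (t + m)) (M-Mr : ∀ x z → M x (Mr x z) ≡ z)
                    (M-row : ∀ x → Inj (M x)) (2t+g≤ : (t + t) + g ≤ t + m) where

    -- The isotope with entries δ⁻¹ (M x (β y)) has symbol `s i` in row `r i` and column `c i`; here
    -- δ has been moved to the other side.
    FitsPair : (r c s : Fin t → Fin (t + m)) → Fin ((t + m) !) × Fin ((t + m) !) → Set
    FitsPair r c s (β , δ) = ∀ i → M (r i) (perm (t + m) β ⟨$⟩ʳ c i) ≡ perm (t + m) δ ⟨$⟩ʳ s i

    Fits : (r c s : Fin t → Fin (t + m)) → Fin ((t + m) ! * (t + m) !) → Set
    Fits r c s ω = FitsPair r c s (remQuot {(t + m) !} ((t + m) !) ω)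

    Fits? : ∀ r c s ω → Dec (Fits r c s ω)
    Fits? r c s ω = all? (λ i → _ ≟ _)

    -- A greedy choice fixes β on the t columns, and thereby δ on the t symbols; each then has `m !`
    -- completions. The greedy choice can be read off β, so no pair arises twice.
    fits-count : ∀ r c s → Inj c → Inj s → g ^ t * (m ! * m !) ≤ # (Fits? r c s)
    fits-count r c s c-inj s-inj = ≤-# (Fits? r c s) (f ∘ split) (split-inj ∘ f-inj _ _) (f-fits ∘ split)
      where
      open Greedy {g = g} M Mr M-Mr M-row
      open Choices (greedy t r 2t+g≤)
      X = Fin (g ^ t) × Fin (m !) × Fin (m !)
      split : Fin (g ^ t * (m ! * m !)) → X
      split z = let γ , xy = remQuot {g ^ t} (m ! * m !) z in γ , remQuot {m !} (m !) xy
      split-inj : Inj split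
      split-inj eq = remQuot-injective {g ^ t} (m ! * m !)
        (cong₂ _,_ (cong proj₁ eq) (remQuot-injective {m !} (m !) (cong proj₂ eq)))
      β δ : X → Permutation′ (t + m)
      β (γ , x , y) = extension t c (choice γ) c-inj (choice-inj γ) x
      δ (γ , x , y) = extension t s _ s-inj (symbol-inj γ) y
      f : X → Fin ((t + m) ! * (t + m) !)
      f z = combine (code (β z)) (code (δ z))
      f-fits : ∀ z → Fits r c s (f z)
      f-fits z@(γ , x , y) = subst (FitsPair r c s) (sym (remQuot-combine (code (β z)) (code (δ z)))) λ i → begin
        M (r i) (perm _ (code (β z)) ⟨$⟩ʳ c i)  ≡⟨ cong (M (r i)) (perm-code (β z) (c i)) ⟩
        M (r i) (β z ⟨$⟩ʳ c i)                  ≡⟨ cong (M (r i)) (extension-extends t c (choice γ) c-inj (choice-inj γ) x i) ⟩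
        M (r i) (choice γ i)                    ≡⟨ extension-extends t s _ s-inj (symbol-inj γ) y i ⟨
        δ z ⟨$⟩ʳ s i                            ≡⟨ perm-code (δ z) (s i) ⟨
        perm _ (code (δ z)) ⟨$⟩ʳ s i            ∎
        where open ≡-Reasoning
      code-inj : ∀ (π π′ : Permutation′ (t + m)) → code π ≡ code π′ → π ≈ π′
      code-inj π π′ eq i = trans (sym (perm-code π i)) (trans (cong (λ x → perm _ x ⟨$⟩ʳ i) eq) (perm-code π′ i))
      f-inj : ∀ z z′ → f z ≡ f z′ → z ≡ z′
      f-inj z@(γ , x , y) z′@(γ′ , x′ , y′) eq = conclude γ≡γ′ β≈ δ≈
        where
        β≈ : β z ≈ β z′
        β≈ = code-inj (β z) (β z′) (combine-injectiveˡ (code (β z)) (code (δ z)) _ _ eq)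
        δ≈ : δ z ≈ δ z′
        δ≈ = code-inj (δ z) (δ z′) (combine-injectiveʳ (code (β z)) (code (δ z)) _ _ eq)
        γ≡γ′ : γ ≡ γ′
        γ≡γ′ = distinct γ γ′ λ i → trans (sym (extension-extends t c (choice γ) c-inj (choice-inj γ) x i))
          (trans (β≈ (c i)) (extension-extends t c (choice γ′) c-inj (choice-inj γ′) x′ i))
        conclude : γ ≡ γ′ → β z ≈ β z′ → δ z ≈ δ z′ → z ≡ z′
        conclude refl β≈ δ≈ = cong₂ (λ a b → γ , a , b)
          (extension-injective t _ _ _ _ β≈) (extension-injective t _ _ _ _ δ≈)

  -- Orthogonal pairs and cyclic squares

  -- `E` numbers diagonals: by orthogonality the cells with a given value of `E` form a transversal
  -- of `S`, so `S` splits into n disjoint transversals. `Er` and `Ec` locate the cell of a diagonal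
  -- in a given row or column.
  record OrthogonalPair (n : ℕ) : Set where
    field
      S E : Fin n → Fin n → Fin n
      S-row : ∀ a → Inj (S a)
      S-col : ∀ b → Inj (λ a → S a b)
      E-row : ∀ a → Inj (E a)
      E-col : ∀ b → Inj (λ a → E a b)
      orthogonal : ∀ {a b a′ b′} → S a b ≡ S a′ b′ → E a b ≡ E a′ b′ → a ≡ a′ × b ≡ b′

    Er : Fin n → Fin n → Fin n
    Er a d = proj₁ (injective⇒surjective (E-row a) d)

    E-Er : ∀ a d → E a (Er a d) ≡ d
    E-Er a d = proj₂ (injective⇒surjective (E-row a) d)

    Ec : Fin n → Fin n → Fin n
    Ec d b = proj₁ (injective⇒surjective (E-col b) d)

    E-Ec : ∀ d b → E (Ec d b) b ≡ d
    E-Ec d b = proj₂ (injective⇒surjective (E-col b) d)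

  transposed : ∀ {n} → OrthogonalPair n → OrthogonalPair n
  transposed O = record
    { S = λ b a → S a b ; E = λ b a → E a b ; S-row = S-col ; S-col = S-row ; E-row = E-col ; E-col = E-row
    ; orthogonal = λ eqS eqE → let a≡ , b≡ = orthogonal eqS eqE in b≡ , a≡ }
    where open OrthogonalPair O

  module Cyclic (h : ℕ) where

    n : ℕ
    n = suc (h + h)

    infix 4 _~_
    -- Congruence modulo n, with multiples on both sides because subtraction is truncated.
    _~_ : ℕ → ℕ → Set
    x ~ y = ∃ λ p → ∃ λ q → x + p * n ≡ y + q * n

    ⟦_⟧ : ℕ → Fin n
    ⟦ x ⟧ = fromℕ< (m%n<n x n)

    ⟦⟧≡⇒~ : ∀ {x y} → ⟦ x ⟧ ≡ ⟦ y ⟧ → x ~ y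
    ⟦⟧≡⇒~ {x} {y} eq = y / n , x / n , (begin
      x + y / n * n                   ≡⟨ cong (_+ y / n * n) (m≡m%n+[m/n]*n x n) ⟩
      x % n + x / n * n + y / n * n   ≡⟨ cong (λ r → r + x / n * n + y / n * n) (fromℕ<-injective _ _ _ _ eq) ⟩
      y % n + x / n * n + y / n * n   ≡⟨ swap (y % n) _ _ ⟩
      y % n + y / n * n + x / n * n   ≡⟨ cong (_+ x / n * n) (m≡m%n+[m/n]*n y n) ⟨
      y + x / n * n                   ∎)
      where
      open ≡-Reasoning
      swap : ∀ a b c → a + b + c ≡ a + c + b
      swap = solve-∀

    ~⇒≡ : ∀ {a b : Fin n} → toℕ a ~ toℕ b → a ≡ b
    ~⇒≡ {a} {b} (p , q , eq) = toℕ-injective (begin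
      toℕ a                   ≡⟨ m<n⇒m%n≡m (toℕ<n a) ⟨
      toℕ a % n               ≡⟨ [m+kn]%n≡m%n (toℕ a) p n ⟨
      (toℕ a + p * n) % n     ≡⟨ cong (_% n) eq ⟩
      (toℕ b + q * n) % n     ≡⟨ [m+kn]%n≡m%n (toℕ b) q n ⟩
      toℕ b % n               ≡⟨ m<n⇒m%n≡m (toℕ<n b) ⟩
      toℕ b                   ∎)
      where open ≡-Reasoning

    ~-cancelˡ : ∀ z {x y} → z + x ~ z + y → x ~ y
    ~-cancelˡ z {x} {y} (p , q , eq) =
      p , q , +-cancelˡ-≡ z _ _ (trans (sym (+-assoc z x _)) (trans eq (+-assoc z y _)))

    ~-cancelʳ : ∀ z {x y} → x + z ~ y + z → x ~ y
    ~-cancelʳ z {x} {y} eq = ~-cancelˡ z (subst₂ _~_ (+-comm x z) (+-comm y z) eq)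

    -- h + 1 inverts 2 modulo n.
    ~-halve : ∀ {x y} → x + x ~ y + y → x ~ y
    ~-halve {x} {y} (p , q , eq) = x + p * suc h , y + q * suc h ,
      trans (expand h x p) (trans (cong (_* suc h) eq) (sym (expand h y q)))
      where
      expand : ∀ h x p → x + (x + p * suc h) * suc (h + h) ≡ (x + x + p * suc (h + h)) * suc h
      expand = solve-∀

    -- From y = (x + 2y) - (x + y), carried out without subtraction by adding the first congruence
    -- to the reverse of the second.
    ~-subtract : ∀ {x y x′ y′} → x + (y + y) ~ x′ + (y′ + y′) → x + y ~ x′ + y′ → y ~ y′
    ~-subtract {x} {y} {x′} {y′} (p , q , eq) (p′ , q′ , eq′) = p + q′ , q + p′ ,
      +-cancelˡ-≡ (x + y + x′ + y′) _ _
        (trans (left x y x′ y′ p q′ n) (trans (cong₂ _+_ eq (sym eq′)) (right x y x′ y′ q p′ n)))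
      where
      left : ∀ x y x′ y′ p q′ n → x + y + x′ + y′ + (y + (p + q′) * n) ≡ x + (y + y) + p * n + (x′ + y′ + q′ * n)
      left = solve-∀
      right : ∀ x y x′ y′ q p′ n → x′ + (y′ + y′) + q * n + (x + y + p′ * n) ≡ x + y + x′ + y′ + (y′ + (q + p′) * n)
      right = solve-∀

    cyclicPair : OrthogonalPair n
    cyclicPair = record
      { S = λ a b → ⟦ toℕ a + (toℕ b + toℕ b) ⟧
      ; E = λ a b → ⟦ toℕ a + toℕ b ⟧
      ; S-row = λ a eq → ~⇒≡ (~-halve (~-cancelˡ (toℕ a) (⟦⟧≡⇒~ eq)))
      ; S-col = λ b eq → ~⇒≡ (~-cancelʳ (toℕ b + toℕ b) (⟦⟧≡⇒~ eq))
      ; E-row = λ a eq → ~⇒≡ (~-cancelˡ (toℕ a) (⟦⟧≡⇒~ eq))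
      ; E-col = λ b eq → ~⇒≡ (~-cancelʳ (toℕ b) (⟦⟧≡⇒~ eq))
      ; orthogonal = orth
      }
      where
      orth : ∀ {a b a′ b′} → ⟦ toℕ a + (toℕ b + toℕ b) ⟧ ≡ ⟦ toℕ a′ + (toℕ b′ + toℕ b′) ⟧ →
             ⟦ toℕ a + toℕ b ⟧ ≡ ⟦ toℕ a′ + toℕ b′ ⟧ → a ≡ a′ × b ≡ b′
      orth {a} {b} {a′} {b′} eqS eqE with ~⇒≡ {b} {b′} (~-subtract {toℕ a} {x′ = toℕ a′} (⟦⟧≡⇒~ eqS) (⟦⟧≡⇒~ eqE))
      ... | refl = ~⇒≡ (~-cancelʳ (toℕ b) (⟦⟧≡⇒~ eqE)) , refl

  -- Prolongation and block squares

  Latin : {V : Set} → (V → V → V) → Set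
  Latin L = (∀ u → Inj (L u)) × (∀ v → Inj (λ u → L u v))

  module Embedding {m r : ℕ} (r≤m : r ≤ m) where
    embed : Fin r → Fin m
    embed e = inject≤ e r≤m

    embed-injective : Inj embed
    embed-injective eq = inject≤-injective r≤m r≤m _ _ eq

    cell? : ∀ (d : Fin m) → Dec (∃ λ e → embed e ≡ d)
    cell? d with toℕ d ℕ.<? r
    ... | yes d<r = yes (fromℕ< d<r , toℕ-injective (trans (toℕ-inject≤ _ r≤m) (toℕ-fromℕ< d<r)))
    ... | no  d≮r = no λ { (e , refl) → d≮r (subst (_< r) (sym (toℕ-inject≤ e r≤m)) (toℕ<n e)) }

  module Prolongation {m r : ℕ} (r≤m : r ≤ m) (corner : Fin r → Fin r → Fin r) (O : OrthogonalPair m) where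
    open OrthogonalPair O
    open Embedding r≤m

    W : Set
    W = Fin m ⊎ Fin r

    inner : ∀ x y → Dec (∃ λ e → embed e ≡ E x y) → W
    inner x y (yes (e , _)) = inj₂ e
    inner x y (no _)        = inj₁ (S x y)

    right : Fin m → Fin r → Fin m
    right x e = S x (Er x (embed e))

    below : Fin r → Fin m → Fin m
    below e y = S (Ec (embed e) y) y

    -- Diagonal `embed e` gives way to the new symbol e; the symbol displaced from a cell reappears
    -- in its row in the new column e and in its column in the new row e. As the diagonal is a
    -- transversal of `S`, each new row and column receives every old symbol once.
    P : W → W → W
    P (inj₁ x) (inj₁ y) = inner x y (cell? (E x y))
    P (inj₁ x) (inj₂ e) = inj₁ (right x e)
    P (inj₂ e) (inj₁ y) = inj₁ (below e y)
    P (inj₂ e) (inj₂ f) = inj₂ (corner e f)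

    inner-injective : ∀ x y y′ c c′ → inner x y c ≡ inner x y′ c′ → y ≡ y′
    inner-injective x y y′ (yes (e , p)) (yes (e′ , p′)) eq =
      E-row x (trans (sym p) (trans (cong embed (inj₂-injective eq)) p′))
    inner-injective x y y′ (no _) (no _) eq = S-row x (inj₁-injective eq)

    -- In row x the symbol `right x e` belonged to the cell on the diagonal of e, and exactly there
    -- it was displaced.
    inner≢right : ∀ x y e c → inner x y c ≢ inj₁ (right x e)
    inner≢right x y e (no ¬c) eq with S-row x (inj₁-injective eq)
    ... | refl = ¬c (e , sym (E-Er x (embed e)))

    below-injective : ∀ e → Inj (below e)
    below-injective e {y} {y′} eq =
      proj₂ (orthogonal eq (trans (E-Ec (embed e) y) (sym (E-Ec (embed e) y′))))

    right-injective : ∀ x → Inj (right x)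
    right-injective x {e} {e′} eq = embed-injective
      (trans (sym (E-Er x (embed e))) (trans (cong (E x) (S-row x eq)) (E-Er x (embed e′))))

    P-row : (∀ e → Inj (corner e)) → ∀ u → Inj (P u)
    P-row corner-row (inj₁ x) {inj₁ y} {inj₁ y′} eq = cong inj₁ (inner-injective x y y′ _ _ eq)
    P-row corner-row (inj₁ x) {inj₁ y} {inj₂ e}  eq = contradiction eq (inner≢right x y e _)
    P-row corner-row (inj₁ x) {inj₂ e} {inj₁ y}  eq = contradiction (sym eq) (inner≢right x y e _)
    P-row corner-row (inj₁ x) {inj₂ e} {inj₂ e′} eq = cong inj₂ (right-injective x (inj₁-injective eq))
    P-row corner-row (inj₂ f) {inj₁ y} {inj₁ y′} eq = cong inj₁ (below-injective f (inj₁-injective eq))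
    P-row corner-row (inj₂ f) {inj₂ e} {inj₂ e′} eq = cong inj₂ (corner-row f (inj₂-injective eq))

  module _ {m r : ℕ} (r≤m : r ≤ m) (corner : Fin r → Fin r → Fin r) (O : OrthogonalPair m) where
    private
      module X = Prolongation r≤m corner O
      module Y = Prolongation r≤m (λ e f → corner f e) (transposed O)

    -- The construction commutes with transposition, so the column half of the Latin property
    -- follows from the row half for the transposed data.
    prolongation-transposed : ∀ u v → Y.P u v ≡ X.P v u
    prolongation-transposed (inj₁ x) (inj₁ y) with Embedding.cell? r≤m (OrthogonalPair.E O y x)
    ... | yes _ = refl
    ... | no  _ = refl
    prolongation-transposed (inj₁ x) (inj₂ e) = refl
    prolongation-transposed (inj₂ e) (inj₁ y) = refl
    prolongation-transposed (inj₂ e) (inj₂ f) = refl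

    prolongation-latin : Latin corner → Latin X.P
    prolongation-latin (row , col) = X.P-row row , λ v {u} {u′} eq → Y.P-row col v
      (trans (prolongation-transposed v u) (trans eq (sym (prolongation-transposed v u′))))

  module _ {k m r : ℕ} where
    emb : Fin k → Fin m ⊎ Fin r → (Fin k × Fin m) ⊎ Fin r
    emb c (inj₁ x) = inj₁ (c , x)
    emb c (inj₂ e) = inj₂ e

    emb-injective : ∀ c → Inj (emb c)
    emb-injective c {inj₁ x} {inj₁ y} eq = cong inj₁ (,-injectiveʳ (inj₁-injective eq))
    emb-injective c {inj₂ x} {inj₂ y} eq = cong inj₂ (inj₂-injective eq)

    emb-class : ∀ c w {c′ z} → emb c w ≡ inj₁ (c′ , z) → c ≡ c′
    emb-class c (inj₁ x) eq = ,-injectiveˡ (inj₁-injective eq)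

  module BlockSquare {k m r : ℕ} (r≤m : r ≤ m) (corner : Fin r → Fin r → Fin r) (O : OrthogonalPair m)
                     (O′ : OrthogonalPair k) (special : Fin k) (block : Fin k → Fin k → Fin m → Fin m → Fin m) where
    open OrthogonalPair O′
    open Prolongation r≤m corner O using (W; P; right; below; right-injective; below-injective; P-row)

    private
      V = (Fin k × Fin m) ⊎ Fin r

    inblock : ∀ a b → Fin m → Fin m → Dec (E a b ≡ special) → V
    inblock a b x y (yes _) = emb (S a b) (P (inj₁ x) (inj₁ y))
    inblock a b x y (no  _) = inj₁ (S a b , block a b x y)

    -- The special blocks form a diagonal of `O′`, so every row class, column class and symbol class
    -- meets exactly one of them. They can therefore share the r new rows, columns and symbols, and
    -- one corner.
    L : V → V → V
    L (inj₁ (a , x)) (inj₁ (b , y)) = inblock a b x y (E a b ≟ special)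
    L (inj₁ (a , x)) (inj₂ e)       = inj₁ (S a (Er a special) , right x e)
    L (inj₂ e)       (inj₁ (b , y)) = inj₁ (S (Ec special b) b , below e y)
    L (inj₂ e)       (inj₂ f)       = inj₂ (corner e f)

    module _ (block-row : ∀ a b x → Inj (block a b x)) (corner-row : ∀ e → Inj (corner e)) where

      inblock-injective : ∀ a x b b′ y y′ d d′ → inblock a b x y d ≡ inblock a b′ x y′ d′ → (b , y) ≡ (b′ , y′)
      inblock-injective a x b b′ y y′ (yes p) (yes p′) eq with E-row a (trans p (sym p′))
      ... | refl = cong (b ,_) (inj₁-injective (P-row corner-row (inj₁ x) (emb-injective _ eq)))
      inblock-injective a x b b′ y y′ (no _) (no _) eq with S-row a (,-injectiveˡ (inj₁-injective eq))
      ... | refl = cong (b ,_) (block-row a b x (,-injectiveʳ (inj₁-injective eq)))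
      -- Equal symbol classes put both cells into one block, which cannot be special and ordinary at
      -- once.
      inblock-injective a x b b′ y y′ (yes p) (no ¬p) eq with S-row a (emb-class _ (P (inj₁ x) (inj₁ y)) eq)
      ... | refl = contradiction p ¬p
      inblock-injective a x b b′ y y′ (no ¬p) (yes p) eq with S-row a (emb-class _ (P (inj₁ x) (inj₁ y′)) (sym eq))
      ... | refl = contradiction p ¬p

      inblock≢right : ∀ a x b y e d → inblock a b x y d ≢ inj₁ (S a (Er a special) , right x e)
      inblock≢right a x b y e (yes p) eq with E-row a (trans p (sym (E-Er a special)))
      ... | refl with P-row corner-row (inj₁ x) {inj₁ y} {inj₂ e} (emb-injective (S a b) eq)
      ... | ()
      inblock≢right a x b y e (no ¬p) eq with S-row a (,-injectiveˡ (inj₁-injective eq))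
      ... | refl = ¬p (E-Er a special)

      L-row : ∀ u → Inj (L u)
      L-row (inj₁ (a , x)) {inj₁ (b , y)} {inj₁ (b′ , y′)} eq = cong inj₁ (inblock-injective a x b b′ y y′ (E a b ≟ special) (E a b′ ≟ special) eq)
      L-row (inj₁ (a , x)) {inj₁ (b , y)} {inj₂ e}  eq = contradiction eq (inblock≢right a x b y e (E a b ≟ special))
      L-row (inj₁ (a , x)) {inj₂ e} {inj₁ (b , y)}  eq = contradiction (sym eq) (inblock≢right a x b y e (E a b ≟ special))
      L-row (inj₁ (a , x)) {inj₂ e} {inj₂ e′}       eq = cong inj₂ (right-injective x (,-injectiveʳ (inj₁-injective eq)))
      L-row (inj₂ e) {inj₁ (b , y)} {inj₁ (b′ , y′)} eq
        with orthogonal (,-injectiveˡ (inj₁-injective eq)) (trans (E-Ec special b) (sym (E-Ec special b′)))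
      ... | _ , refl = cong (λ y → inj₁ (b , y)) (below-injective e (,-injectiveʳ (inj₁-injective eq)))
      L-row (inj₂ e) {inj₂ f} {inj₂ f′} eq = cong inj₂ (corner-row e (inj₂-injective eq))

  module _ {k m r : ℕ} (r≤m : r ≤ m) (corner : Fin r → Fin r → Fin r) (O : OrthogonalPair m)
           (O′ : OrthogonalPair k) (special : Fin k) (block : Fin k → Fin k → Fin m → Fin m → Fin m) where
    private
      module X = BlockSquare r≤m corner O O′ special block
      module Y = BlockSquare r≤m (λ e f → corner f e) (transposed O) (transposed O′) special (λ b a y x → block a b x y)

    blockSquare-transposed : ∀ u v → Y.L u v ≡ X.L v u
    blockSquare-transposed (inj₁ (b , y)) (inj₁ (a , x)) with OrthogonalPair.E O′ a b ≟ special
    ... | yes _ = cong (emb _) (prolongation-transposed r≤m corner O (inj₁ y) (inj₁ x))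
    ... | no  _ = refl
    blockSquare-transposed (inj₁ _) (inj₂ e) = refl
    blockSquare-transposed (inj₂ e) (inj₁ _) = refl
    blockSquare-transposed (inj₂ e) (inj₂ f) = refl

    blockSquare-latin : Latin corner → (∀ a b → Latin (block a b)) → Latin X.L
    blockSquare-latin (row , col) block-latin =
      X.L-row (λ a b → proj₁ (block-latin a b)) row ,
      λ v {u} {u′} eq → Y.L-row (λ b a → proj₂ (block-latin a b)) col v
        (trans (blockSquare-transposed v u) (trans eq (sym (blockSquare-transposed v u′))))

  -- Balanced words

  cast-injective : ∀ {m n} (eq : m ≡ n) → Inj (cast eq)
  cast-injective eq {i} {j} ci≡cj =
    toℕ-injective (trans (sym (toℕ-cast eq i)) (trans (cong toℕ ci≡cj) (toℕ-cast eq j)))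

  funToFin-cong : ∀ {m n} {f g : Fin m → Fin n} → f ≗ g → funToFin f ≡ funToFin g
  funToFin-cong {zero}  eq = refl
  funToFin-cong {suc m} eq = cong₂ combine (eq zero) (funToFin-cong (eq ∘ suc))

  finToFun-injective : ∀ m n {x y : Fin (m ^ n)} → finToFun {m} {n} x ≗ finToFun y → x ≡ y
  finToFun-injective m n {x} {y} eq =
    trans (sym (funToFin-finToFin {n} {m} x)) (trans (funToFin-cong eq) (funToFin-finToFin {n} {m} y))

  sum-↑ : ∀ a b (f : Fin (a + b) → ℕ) → sum f ≡ sum (f ∘ (_↑ˡ b)) + sum (f ∘ (a ↑ʳ_))
  sum-↑ zero    b f = refl
  sum-↑ (suc a) b f = trans (cong (f zero +_) (sum-↑ a b (f ∘ suc))) (sym (+-assoc (f zero) _ _))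

  sum-combine : ∀ a b (f : Fin (a * b) → ℕ) → sum f ≡ sum (λ i → sum (λ j → f (combine {a} i j)))
  sum-combine zero    b f = refl
  sum-combine (suc a) b f = trans (sum-↑ b (a * b) f) (cong (sum (f ∘ (_↑ˡ (a * b))) +_) (sum-combine a b (f ∘ (b ↑ʳ_))))

  []₀₁-cong : {P Q : Set} (p : Dec P) (q : Dec Q) → P ⇔ Q → [ p ]₀₁ ≡ [ q ]₀₁
  []₀₁-cong p q P⇔Q = cong (if_then 1 else 0) (does-⇔ P⇔Q p q)

  []₀₁≤1 : {P : Set} (p : Dec P) → [ p ]₀₁ ≤ 1
  []₀₁≤1 (yes _) = ≤-refl
  []₀₁≤1 (no  _) = z≤n

  occ : ∀ {n s} → (Fin n → Fin s) → Fin s → ℕ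
  occ u d = # (λ i → u i ≟ d)

  sum-zero : ∀ n → sum {n} (λ _ → 0) ≡ 0
  sum-zero n = trans (sum-const n 0) (*-zeroʳ n)

  sum-indicator : ∀ {s} (e : Fin s) → sum (λ d → [ e ≟ d ]₀₁) ≡ 1
  sum-indicator {suc s} zero    = cong suc (sum-zero s)
  sum-indicator {suc s} (suc e) = trans (sum-cong-≗ (λ d → []₀₁-cong (suc e ≟ suc d) (e ≟ d)
    (mk⇔ Data.Fin.Properties.suc-injective (cong suc)))) (sum-indicator e)

  sum-occ : ∀ {n s} (u : Fin n → Fin s) → sum (occ u) ≡ n
  sum-occ {n} u = begin
    sum (λ d → sum (λ i → [ u i ≟ d ]₀₁))  ≡⟨ ∑-comm (λ d i → [ u i ≟ d ]₀₁) ⟩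
    sum (λ i → sum (λ d → [ u i ≟ d ]₀₁))  ≡⟨ sum-cong-≗ (sum-indicator ∘ u) ⟩
    sum {n} (λ _ → 1)                      ≡⟨ sum-const n 1 ⟩
    n * 1                                  ≡⟨ *-identityʳ n ⟩
    n                                      ∎
    where open ≡-Reasoning

  #≤n : ∀ {n} {P : Fin n → Set} (P? : ∀ i → Dec (P i)) → # P? ≤ n
  #≤n {n} P? = ≤-trans (sum-mono-≤ ([]₀₁≤1 ∘ P?)) (≤-reflexive (trans (sum-const n 1) (*-identityʳ n)))

  module BalancedWords {s′ : ℕ} (O : OrthogonalPair (suc s′)) (t : ℕ) where
    open OrthogonalPair O using (E; E-row; E-col; Er; E-Er)

    s : ℕ
    s = suc s′

    private instance
      profiles≢0 : NonZero (suc t ^ s)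
      profiles≢0 = m^n≢0 (suc t) s

    decode : Fin (s ^ t) → Fin t → Fin s
    decode = finToFun

    occFin : (Fin t → Fin s) → Fin s → Fin (suc t)
    occFin u d = fromℕ< (s≤s (#≤n (λ i → u i ≟ d)))

    -- Letter counts, coded as a number. There are at most (t + 1)^s of them against s^t words, so
    -- fixing the profile costs only a factor polynomial in t.
    profile : Fin (s ^ t) → Fin (suc t ^ s)
    profile x = funToFin (occFin (decode x))

    profile≡⇒occ≡ : ∀ {x y} → profile x ≡ profile y → occ (decode x) ≗ occ (decode y)
    profile≡⇒occ≡ {x} {y} eq d = fromℕ<-injective _ _ _ _ (begin
      occFin (decode x) d     ≡⟨ finToFun-funToFin (occFin (decode x)) d ⟨
      finToFun {suc t} {s} (profile x) d    ≡⟨ cong (λ z → finToFun {suc t} {s} z d) eq ⟩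
      finToFun {suc t} {s} (profile y) d    ≡⟨ finToFun-funToFin (occFin (decode y)) d ⟩
      occFin (decode y) d     ∎)
      where open ≡-Reasoning

    module WithProfile (p : Fin (suc t ^ s)) where

      hasProfile? : ∀ x → Dec (profile x ≡ p)
      hasProfile? x = profile x ≟ p

      w : ℕ
      w = # hasProfile?

      letters : Fin w → Fin t → Fin s
      letters x = decode (proj₁ (enumerate hasProfile?) x)

      letters-occ : ∀ x y → occ (letters x) ≗ occ (letters y)
      letters-occ x y = profile≡⇒occ≡ {proj₁ (enumerate hasProfile?) x} {proj₁ (enumerate hasProfile?) y} (trans (profile-p x) (sym (profile-p y)))
        where 
        profile-p = proj₂ (proj₂ (enumerate hasProfile?))

      letters-injective : ∀ {x y} → letters x ≗ letters y → x ≡ y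
      letters-injective {x} {y} eq = proj₁ (proj₂ (enumerate hasProfile?)) (finToFun-injective s t eq)

      decodeˢ : Fin (w ^ s) → Fin s → Fin w
      decodeˢ = finToFun

      -- Shifting the j-th of s words with a common profile by the j-th row of a Latin square
      -- balances the numbers of occurrences.
      segment : Fin (w ^ s) → Fin s → Fin t → Fin s
      segment v j i = E j (letters (decodeˢ v j) i)

      word : Fin (w ^ s) → Fin (s * t) → Fin s
      word v y = uncurry (segment v) (remQuot {s} t y)

      word-combine : ∀ v j i → word v (combine {s} {t} j i) ≡ segment v j i
      word-combine v j i = cong (uncurry (segment v)) (remQuot-combine {s} {t} j i)

      Er-inj : ∀ d → Inj (λ j → Er j d)
      Er-inj d {j} {j′} eq = E-col (Er j d) (trans (E-Er j d) (sym (trans (cong (E j′) eq) (E-Er j′ d))))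

      -- Letter d occurs in the shifted j-th segment as often as `Er j d` does in the unshifted
      -- word. As j varies, `Er j d` runs through all letters, and the common profile makes these
      -- counts add up to the length t of one word.
      word-occ : ∀ v d → occ (word v) d ≡ t
      word-occ v d = begin
        sum (λ y → [ word v y ≟ d ]₀₁)                            ≡⟨ sum-combine s t (λ y → [ word v y ≟ d ]₀₁) ⟩
        sum (λ j → sum (λ i → [ word v (combine {s} {t} j i) ≟ d ]₀₁))    ≡⟨ sum-cong-≗ {s} (λ j → sum-cong-≗ {t} (shift j)) ⟩
        sum (λ j → occ (letters (decodeˢ v j)) (Er j d))         ≡⟨ sum-cong-≗ {s} (λ j → letters-occ (decodeˢ v j) u (Er j d)) ⟩
        sum (λ j → occ (letters u) (Er j d))                      ≡⟨ sum-permute (occ (letters u)) (injective⇒permutation _ (Er-inj d)) ⟨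
        sum (occ (letters u))                                     ≡⟨ sum-occ (letters u) ⟩
        t                                                         ∎
        where
        open ≡-Reasoning
        u = decodeˢ v zero
        shift : ∀ j i → [ word v (combine {s} {t} j i) ≟ d ]₀₁ ≡ [ letters (decodeˢ v j) i ≟ Er j d ]₀₁
        shift j i = []₀₁-cong (word v (combine {s} {t} j i) ≟ d) (letters (decodeˢ v j) i ≟ Er j d) (mk⇔
          (λ eq → E-row j (trans (trans (sym (word-combine v j i)) eq) (sym (E-Er j d))))
          (λ eq → trans (word-combine v j i) (trans (cong (E j) eq) (E-Er j d))))

      rankOf : ∀ v d y → word v y ≡ d → Fin t
      rankOf v d y eq = cast (word-occ v d) (proj₁ (rank (λ y → word v y ≟ d)) y eq)

      rankOf-injective : ∀ v d d′ y y′ eq eq′ → d ≡ d′ → rankOf v d y eq ≡ rankOf v d′ y′ eq′ → y ≡ y′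
      rankOf-injective v d .d y y′ eq eq′ refl r≡r′ = proj₂ (rank (λ y → word v y ≟ d)) y y′ eq eq′
        (cast-injective (word-occ v d) r≡r′)

      -- The letter at y together with the rank of y among the places of that letter: balance makes
      -- this a bijection, from which the word can be read off.
      cell : Fin (w ^ s) → Fin (s * t) → Fin (s * t)
      cell v y = combine (word v y) (rankOf v (word v y) y refl)

      cell-injective : ∀ v → Inj (cell v)
      cell-injective v {y} {y′} eq = rankOf-injective v _ _ y y′ refl refl
        (combine-injectiveˡ (word v y) _ (word v y′) _ eq) (combine-injectiveʳ (word v y) _ (word v y′) _ eq)

      arrangement : Fin (w ^ s) → Permutation′ (s * t)
      arrangement v = injective⇒permutation (cell v) (cell-injective v)

      arrangement-letter : ∀ v y → proj₁ (remQuot {s} t (arrangement v ⟨$⟩ʳ y)) ≡ word v y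
      arrangement-letter v y = cong proj₁ (remQuot-combine {s} {t} (word v y) (rankOf v (word v y) y refl))

      arrangement-distinct : ∀ v v′ →
        (∀ y → proj₁ (remQuot {s} t (arrangement v ⟨$⟩ʳ y)) ≡ proj₁ (remQuot {s} t (arrangement v′ ⟨$⟩ʳ y))) → v ≡ v′
      arrangement-distinct v v′ eq = finToFun-injective w s λ j → letters-injective λ i → E-row j (begin
        segment v j i            ≡⟨ word-combine v j i ⟨
        word v (combine j i)     ≡⟨ arrangement-letter v (combine j i) ⟨
        _                        ≡⟨ eq (combine j i) ⟩
        _                        ≡⟨ arrangement-letter v′ (combine j i) ⟩
        word v′ (combine j i)    ≡⟨ word-combine v′ j i ⟩
        segment v′ j i           ∎)
        where open ≡-Reasoning

    record Arrangements : Set where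
      field
        W        : ℕ
        W-bound  : s ^ (t * s) ≤ suc t ^ (s * s) * W
        arrange  : Fin W → Permutation′ (s * t)
        distinct : ∀ v v′ →
          (∀ y → proj₁ (remQuot {s} t (arrange v ⟨$⟩ʳ y)) ≡ proj₁ (remQuot {s} t (arrange v′ ⟨$⟩ʳ y))) → v ≡ v′

    -- Pigeonhole on profiles gives enough balanced words up to a factor polynomial in t, with no
    -- estimate of the multinomial coefficient (st)! / (t!)^s.
    arrangements : Arrangements
    arrangements = record
      { W = w ^ s ; W-bound = bound ; arrange = arrangement ; distinct = arrangement-distinct }
      where
      hit : ∀ x → 1 ≤ # (λ ω → profile x ≟ ω)
      hit x = ≤-# {q = 1} (λ ω → profile x ≟ ω) (λ _ → profile x) (λ { {zero} {zero} _ → refl }) (λ _ → refl)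
      best = popular {q = 1} (λ x ω → profile x ≟ ω) hit
      open WithProfile (proj₁ best)
      bound : s ^ (t * s) ≤ suc t ^ (s * s) * w ^ s
      bound = begin
        s ^ (t * s)                   ≡⟨ ^-*-assoc s t s ⟨
        (s ^ t) ^ s                   ≤⟨ ^-monoˡ-≤ s (≤-trans (≤-reflexive (sym (*-identityʳ (s ^ t)))) (proj₂ best)) ⟩
        (suc t ^ s * w) ^ s           ≡⟨ ^-distribʳ-* s (suc t ^ s) w ⟩
        (suc t ^ s) ^ s * w ^ s       ≡⟨ cong (_* w ^ s) (^-*-assoc (suc t) s s) ⟩
        suc t ^ (s * s) * w ^ s       ∎
        where open ≤-Reasoning

  -- Placements in the block square

  ManyTransversals : {V : Set} → (V → V → V) → ℕ → Set
  ManyTransversals {V} L N = Σ (Fin N → V → V) λ σ →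
    (∀ j → Inj (σ j) × Inj (λ u → L u (σ j u))) × (∀ {i j} → σ i ≗ σ j → i ≡ j)

  module Transport {n : ℕ} {V : Set} (I : Fin n ↔ V) where
    open Inverse I using (to; from)

    to-from : ∀ v → to (from v) ≡ v
    to-from v = Inverse.inverseˡ I refl

    from-to : ∀ i → from (to i) ≡ i
    from-to i = Inverse.inverseʳ I refl

    to-injective : Inj to
    to-injective eq = trans (sym (from-to _)) (trans (cong from eq) (from-to _))

    from-injective : Inj from
    from-injective eq = trans (sym (to-from _)) (trans (cong to eq) (to-from _))

    carry : (V → V → V) → Fin n → Fin n → Fin n
    carry L i j = from (L (to i) (to j))

    carry-latin : ∀ {L} → Latin L → IsLatinSquare n (carry L)
    carry-latin (row , col) =
      (λ i eq → to-injective (row (to i) (from-injective eq))) ,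
      (λ j eq → to-injective (col (to j) (from-injective eq)))

    carry-transversals : ∀ {L N} → ManyTransversals L N → HasAtLeastTransversals n (carry L) N
    carry-transversals {L} (σ , σ-transversal , σ-distinct) =
      (λ j → from ∘ σ j ∘ to) ,
      (λ j → (λ eq → to-injective (proj₁ (σ-transversal j) (from-injective eq))) ,
             (λ {x} {y} eq → to-injective (proj₂ (σ-transversal j) (from-injective
               (trans (sym (carried j x)) (trans eq (carried j y))))))) ,
      (λ {i} {j} eq → σ-distinct λ v → from-injective
        (trans (cong (from ∘ σ i) (sym (to-from v))) (trans (eq (from v)) (cong (from ∘ σ j) (to-from v)))))
      where
      carried : ∀ j i → carry L i (from (σ j (to i))) ≡ from (L (to i) (σ j (to i)))
      carried j i = cong (from ∘ L (to i)) (to-from _)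

  -- Serves as the corner: in the new rows every placement follows this one transversal.
  record LatinWithTransversal (r : ℕ) : Set where
    field
      square      : Fin r → Fin r → Fin r
      latin       : Latin square
      transversal : Fin r → Fin r
      columns-inj : Inj transversal
      symbols-inj : Inj (λ i → square i (transversal i))

  module Construction
    (s₂ t : ℕ) {r : ℕ} (r≤m : r ≤ (2 + s₂) * t) (Oₛ : OrthogonalPair (2 + s₂)) (Oₖ : OrthogonalPair (4 + s₂))
    (Oₘ : OrthogonalPair ((2 + s₂) * t)) (C : LatinWithTransversal r) where

    open OrthogonalPair Oₖ
    module M = OrthogonalPair Oₘ
    open LatinWithTransversal C
    open BalancedWords.Arrangements (BalancedWords.arrangements Oₛ t)

    s k m : ℕ
    s = suc (suc s₂)
    k = suc (suc s)
    m = s * t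

    -- `A` counts placements, `Ω` the pairs of a column and a symbol permutation for one block, and
    -- `q` bounds from below the pairs that suit t prescribed cells; m = t + m′.
    m′ q A Ω : ℕ
    m′ = t + s₂ * t
    q  = (s₂ * t) ^ t * (m′ ! * m′ !)
    A  = W ^ k * ((m !) ^ k * (m !) ^ k)
    Ω  = m ! * m !

    letter : Fin m → Fin s
    letter y = proj₁ (remQuot {s} t y)

    -- The diagonals of the outer square used by placements are numbered from 2 on; diagonal 0
    -- carries the prolonged blocks.
    colClass symClass : Fin k → Fin s → Fin k
    colClass a d = Er a (suc (suc d))
    symClass a d = S a (colClass a d)

    E-colClass : ∀ a d → E a (colClass a d) ≡ suc (suc d)
    E-colClass a d = E-Er a (suc (suc d))

    colClass-injective : ∀ d → Inj (λ a → colClass a d)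
    colClass-injective d {a} {a′} eq =
      E-col (colClass a d) (trans (E-colClass a d) (sym (trans (cong (E a′) eq) (E-colClass a′ d))))

    symClass-injective : ∀ d → Inj (λ a → symClass a d)
    symClass-injective d {a} {a′} eq = proj₁ (orthogonal eq (trans (E-colClass a d) (sym (E-colClass a′ d))))

    -- In row class a, `ψ a` sends each row to a pair (d, i): diagonal d, place i. That row then
    -- takes the column with number (d, i) in the order `κ` of its column class and the symbol with
    -- number (d, i) in the order `μ` of its symbol class.
    record Choice : Set where
      constructor choice
      field
        rows    : Fin (W ^ k)
        cols    : Fin ((m !) ^ k)
        symbols : Fin ((m !) ^ k)

      ψ κ μ : Fin k → Permutation′ m
      ψ a = arrange (finToFun {W} {k} rows a)
      κ b = perm m (finToFun {m !} {k} cols b)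
      μ e = perm m (finToFun {m !} {k} symbols e)

      rowAt colAt symAt : Fin k → Fin s → Fin t → Fin m
      rowAt a d i = ψ a ⟨$⟩ˡ combine d i
      colAt a d i = κ (colClass a d) ⟨$⟩ʳ combine d i
      symAt a d i = μ (symClass a d) ⟨$⟩ʳ combine d i

    open Choice

    toChoice : Fin A → Choice
    toChoice x = let v , yz = remQuot {W ^ k} ((m !) ^ k * (m !) ^ k) x
                     y , z = remQuot {(m !) ^ k} ((m !) ^ k) yz in choice v y z

    toChoice-injective : ∀ {x x′} → toChoice x ≡ toChoice x′ → x ≡ x′
    toChoice-injective eq = remQuot-injective {W ^ k} ((m !) ^ k * (m !) ^ k) (cong₂ _,_ (cong rows eq)
      (remQuot-injective {(m !) ^ k} ((m !) ^ k) (cong₂ _,_ (cong cols eq) (cong symbols eq))))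

    open BlockCount {t} {m′} {s₂ * t} M.E M.Er M.E-Er M.E-row (≤-reflexive (+-assoc t t (s₂ * t)))

    FitsAt : Fin k × Fin s → Choice → Fin Ω → Set
    FitsAt (a , d) x = Fits (rowAt x a d) (colAt x a d) (symAt x a d)

    FitsAt? : ∀ p x ω → Dec (FitsAt p x ω)
    FitsAt? (a , d) x = Fits? (rowAt x a d) (colAt x a d) (symAt x a d)

    FitsAt-count : ∀ p x → q ≤ # (FitsAt? p x)
    FitsAt-count (a , d) x = fits-count (rowAt x a d) (colAt x a d) (symAt x a d)
      (λ eq → combine-injectiveʳ d _ d _ (⟨$⟩ʳ-injective (κ x (colClass a d)) eq))
      (λ eq → combine-injectiveʳ d _ d _ (⟨$⟩ʳ-injective (μ x (symClass a d)) eq))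

    isotope : Fin Ω → Fin m → Fin m → Fin m
    isotope ω x y = perm m (proj₂ βδ) ⟨$⟩ˡ M.E x (perm m (proj₁ βδ) ⟨$⟩ʳ y)
      where βδ = remQuot {m !} (m !) ω

    isotope-latin : ∀ ω → Latin (isotope ω)
    isotope-latin ω =
      (λ x eq → ⟨$⟩ʳ-injective (perm m _) (M.E-row x (⟨$⟩ˡ-injective (perm m _) eq))) ,
      (λ y eq → M.E-col _ (⟨$⟩ˡ-injective (perm m _) eq))

    module Square (ω : Fin (k * s) → Fin Ω) where

      blockAt : Fin k → Fin k → Fin m → Fin m → Fin m
      blockAt a zero          = M.E
      blockAt a (suc zero)    = M.E
      blockAt a (suc (suc d)) = isotope (ω (combine a d))

      blockAt-latin : ∀ a d → Latin (blockAt a d)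
      blockAt-latin a zero          = M.E-row , M.E-col
      blockAt-latin a (suc zero)    = M.E-row , M.E-col
      blockAt-latin a (suc (suc d)) = isotope-latin (ω (combine a d))

      block : Fin k → Fin k → Fin m → Fin m → Fin m
      block a b = blockAt a (E a b)

      V : Set
      V = (Fin k × Fin m) ⊎ Fin r

      open BlockSquare r≤m square Oₘ Oₖ zero block public using (L; inblock)

      L-latin : Latin L
      L-latin = blockSquare-latin r≤m square Oₘ Oₖ zero block latin (λ a b → blockAt-latin a (E a b))

      L-ordinary : ∀ a d x y → L (inj₁ (a , x)) (inj₁ (colClass a d , y)) ≡
                   inj₁ (symClass a d , isotope (ω (combine a d)) x y)
      L-ordinary a d x y = ordinary (E a (colClass a d) ≟ zero)
        where
        ordinary : ∀ dec → inblock a (colClass a d) x y dec ≡ inj₁ (symClass a d , isotope (ω (combine a d)) x y)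
        ordinary (yes p) = contradiction (trans (sym p) (E-colClass a d)) λ ()
        ordinary (no _)  = cong (λ e → inj₁ (symClass a d , blockAt a e x y)) (E-colClass a d)

      place : (Fin k → Fin s → Fin k) → (Fin k → Permutation′ m) → Fin k × Fin m → Fin k × Fin m
      place cls π (a , y) = cls a (letter y) , π (cls a (letter y)) ⟨$⟩ʳ y

      -- Equal images lie in one class, whose permutation gives back y; the letter of y then
      -- recovers a.
      place-injective : ∀ cls π → (∀ d → Inj (λ a → cls a d)) → Inj (place cls π)
      place-injective cls π cls-inj {a , y} {a′ , y′} eq = same (,-injectiveˡ eq) (cong proj₂ eq)
        where
        same : ∀ {c c′} → c ≡ c′ → π c ⟨$⟩ʳ y ≡ π c′ ⟨$⟩ʳ y′ → (a , y) ≡ (a′ , y′)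
        same {c} refl πy≡ with ⟨$⟩ʳ-injective (π c) πy≡
        ... | refl = cong (_, y) (cls-inj (letter y) (,-injectiveˡ eq))

      arranged : Choice → Fin k × Fin m → Fin k × Fin m
      arranged x (a , y) = a , ψ x a ⟨$⟩ʳ y

      arranged-injective : ∀ x → Inj (arranged x)
      arranged-injective x {a , y} {a′ , y′} eq = same (,-injectiveˡ eq) (cong proj₂ eq)
        where
        same : ∀ {a a′} → a ≡ a′ → ψ x a ⟨$⟩ʳ y ≡ ψ x a′ ⟨$⟩ʳ y′ → (a , y) ≡ (a′ , y′)
        same {a} refl ψy≡ = cong (a ,_) (⟨$⟩ʳ-injective (ψ x a) ψy≡)

      -- `σ` gives the columns and `τ` the prescribed symbols. Neither refers to the isotopes, so
      -- both are injective for every choice; the square enters only through `L-σ`.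
      σ τ : Choice → V → V
      σ x (inj₁ u) = inj₁ (place colClass (κ x) (arranged x u))
      σ x (inj₂ e) = inj₂ (transversal e)
      τ x (inj₁ u) = inj₁ (place symClass (μ x) (arranged x u))
      τ x (inj₂ e) = inj₂ (square e (transversal e))

      σ-injective : ∀ x → Inj (σ x)
      σ-injective x {inj₁ u} {inj₁ v} eq = cong inj₁ (arranged-injective x
        (place-injective colClass (κ x) colClass-injective (inj₁-injective eq)))
      σ-injective x {inj₂ e} {inj₂ f} eq = cong inj₂ (columns-inj (inj₂-injective eq))

      τ-injective : ∀ x → Inj (τ x)
      τ-injective x {inj₁ u} {inj₁ v} eq = cong inj₁ (arranged-injective x
        (place-injective symClass (μ x) symClass-injective (inj₁-injective eq)))
      τ-injective x {inj₂ e} {inj₂ f} eq = cong inj₂ (symbols-inj (inj₂-injective eq))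

      AllFit : Choice → Set
      AllFit x = ∀ a d → FitsAt (a , d) x (ω (combine a d))

      L-σ : ∀ x → AllFit x → ∀ u → L u (σ x u) ≡ τ x u
      L-σ x fit (inj₂ e)       = refl
      L-σ x fit (inj₁ (a , y)) = trans (L-ordinary a d y _) (cong (λ z → inj₁ (symClass a d , z)) isotope≡)
        where
        open ≡-Reasoning
        z = ψ x a ⟨$⟩ʳ y
        d = letter z
        i = proj₂ (remQuot {s} t z)
        βδ = remQuot {m !} (m !) (ω (combine a d))
        β = perm m (proj₁ βδ)
        δ = perm m (proj₂ βδ)
        z≡ : combine d i ≡ z
        z≡ = combine-remQuot {s} t z
        FitAt : Fin m → Set
        FitAt w = M.E (ψ x a ⟨$⟩ˡ w) (β ⟨$⟩ʳ (κ x (colClass a d) ⟨$⟩ʳ w)) ≡ δ ⟨$⟩ʳ (μ x (symClass a d) ⟨$⟩ʳ w)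
        isotope≡ : δ ⟨$⟩ˡ M.E y (β ⟨$⟩ʳ (κ x (colClass a d) ⟨$⟩ʳ z)) ≡ μ x (symClass a d) ⟨$⟩ʳ z
        isotope≡ = begin
          δ ⟨$⟩ˡ M.E y (β ⟨$⟩ʳ (κ x (colClass a d) ⟨$⟩ʳ z))
            ≡⟨ cong (λ w → δ ⟨$⟩ˡ M.E w (β ⟨$⟩ʳ (κ x (colClass a d) ⟨$⟩ʳ z))) (Perm.inverseˡ (ψ x a)) ⟨
          δ ⟨$⟩ˡ M.E (ψ x a ⟨$⟩ˡ z) (β ⟨$⟩ʳ (κ x (colClass a d) ⟨$⟩ʳ z))
            ≡⟨ cong (δ ⟨$⟩ˡ_) (subst FitAt z≡ (fit a d i)) ⟩
          δ ⟨$⟩ˡ (δ ⟨$⟩ʳ (μ x (symClass a d) ⟨$⟩ʳ z))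
            ≡⟨ Perm.inverseˡ δ ⟩
          μ x (symClass a d) ⟨$⟩ʳ z ∎

      -- For a fixed letter `cls` runs through all classes, so every value of every permutation in π
      -- is visible.
      place-determines : ∀ cls π π′ → (∀ d → Inj (λ a → cls a d)) →
        (∀ p → place cls π p ≡ place cls π′ p) → ∀ b y → π b ⟨$⟩ʳ y ≡ π′ b ⟨$⟩ʳ y
      place-determines cls π π′ cls-inj eq b y with injective⇒surjective (cls-inj (letter y)) b
      ... | a , refl = ,-injectiveʳ (eq (a , y))

      perms-injective : (x y : Fin ((m !) ^ k)) →
        (∀ b → perm m (finToFun {m !} {k} x b) Perm.≈ perm m (finToFun {m !} {k} y b)) → x ≡ y
      perms-injective x y eq = finToFun-injective (m !) k (λ b → perm-injective m (eq b))

      σ-rows : ∀ x x′ → σ x ≗ σ x′ → rows x ≡ rows x′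
      σ-rows x x′ σ≗ = finToFun-injective W k (λ a → distinct _ _ (λ y →
        suc-injective (suc-injective (trans (sym (E-colClass a _))
          (trans (cong (E a) (,-injectiveˡ (inj₁-injective (σ≗ (inj₁ (a , y)))))) (E-colClass a _))))))

      place≗ : ∀ cls π π′ x → (∀ u → place cls π (arranged x u) ≡ place cls π′ (arranged x u)) →
               ∀ p → place cls π p ≡ place cls π′ p
      place≗ cls π π′ x eq (a , w) =
        subst (λ z → place cls π (a , z) ≡ place cls π′ (a , z)) (Perm.inverseʳ (ψ x a)) (eq (a , ψ x a ⟨$⟩ˡ w))

      -- Column classes reveal the letters, hence `rows`, and the columns then reveal κ. The order
      -- of symbols is invisible in σ alone, but both choices fit the same square, so their symbols
      -- agree as entries of `L` and reveal μ.
      σ-distinct : ∀ x x′ → AllFit x → AllFit x′ → σ x ≗ σ x′ → x ≡ x′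
      σ-distinct x@(choice v y z) x′@(choice v′ y′ z′) fit fit′ σ≗ = conclude (σ-rows x x′ σ≗) σ≗ τ≗
        where
        τ≗ : τ x ≗ τ x′
        τ≗ u = trans (sym (L-σ x fit u)) (trans (cong (L u) (σ≗ u)) (L-σ x′ fit′ u))
        conclude : v ≡ v′ → σ x ≗ σ x′ → τ x ≗ τ x′ → x ≡ x′
        conclude refl σ≗ τ≗ = cong₂ (choice v)
          (perms-injective y y′ (place-determines colClass (κ x) (κ x′) colClass-injective
            (place≗ colClass (κ x) (κ x′) x (λ u → inj₁-injective (σ≗ (inj₁ u))))))
          (perms-injective z z′ (place-determines symClass (μ x) (μ x′) symClass-injective
            (place≗ symClass (μ x) (μ x′) x (λ u → inj₁-injective (τ≗ (inj₁ u))))))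

    n : ℕ
    n = k * m + r

    index : Fin n ↔ ((Fin k × Fin m) ⊎ Fin r)
    index = (*↔× {k} {m} ⊎-↔ ↔-id (Fin r)) ↔-∘ +↔⊎ {k * m} {r}

    ManyTransversalsOfOrder : Set
    ManyTransversalsOfOrder = Σ (Fin n → Fin n → Fin n) λ L → IsLatinSquare n L ×
      Σ ℕ λ N → A * q ^ (k * s) ≤ Ω ^ (k * s) * N × HasAtLeastTransversals n L N

    many-transversals : ManyTransversalsOfOrder
    many-transversals = build (popular-choices {A} {Ω} {q} (k * s)
        (λ b x ω → FitsAt? (remQuot {k} s b) (toChoice x) ω) (λ b x → FitsAt-count (remQuot {k} s b) (toChoice x)))
      where
      instance Ω≢0 = m !* m !≢0
      build : (Σ (Fin (k * s) → Fin Ω) λ ω → Σ ℕ λ N → Σ (Fin N → Fin A) λ g → Inj g ×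
                (∀ b j → FitsAt (remQuot {k} s b) (toChoice (g j)) (ω b)) × A * q ^ (k * s) ≤ Ω ^ (k * s) * N) →
              ManyTransversalsOfOrder
      build (ω , N , g , g-inj , fits , bound) =
        carry L , carry-latin {L} L-latin , N , bound , carry-transversals {L} {N}
          ( (λ j → σ (toChoice (g j)))
          , (λ j → σ-injective _ , λ {u} {v} eq → τ-injective (toChoice (g j))
              (trans (sym (L-σ _ (allFit j) u)) (trans eq (L-σ _ (allFit j) v))))
          , (λ {i} {j} eq → g-inj (toChoice-injective (σ-distinct _ _ (allFit i) (allFit j) eq))))
        where
        open Square ω
        open Transport index
        allFit : ∀ j → AllFit (toChoice (g j))
        allFit j a d = subst (λ p → FitsAt p (toChoice (g j)) (ω (combine a d))) (remQuot-combine a d) (fits (combine a d) j)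

  -- Small Latin squares with a transversal

  even-or-odd : ∀ n → ∃ λ h → n ≡ h + h ⊎ n ≡ suc (h + h)
  even-or-odd zero = 0 , inj₁ refl
  even-or-odd (suc n) with even-or-odd n
  ... | h , inj₁ refl = h , inj₂ refl
  ... | h , inj₂ refl = suc h , inj₁ (cong suc (sym (+-suc h h)))

  module Diagonal {n : ℕ} (O : OrthogonalPair n) (d : Fin n) where
    open OrthogonalPair O

    diagonal-injective : Inj (λ a → Er a d)
    diagonal-injective {a} {a′} eq =
      E-col (Er a d) (trans (E-Er a d) (sym (trans (cong (E a′) eq) (E-Er a′ d))))

    diagonal-symbols-injective : Inj (λ a → S a (Er a d))
    diagonal-symbols-injective {a} {a′} eq = proj₁ (orthogonal eq (trans (E-Er a d) (sym (E-Er a′ d))))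

  odd-order : ∀ h → LatinWithTransversal (suc (h + h))
  odd-order h = record
    { square = S ; latin = S-row , S-col ; transversal = λ a → Er a zero
    ; columns-inj = diagonal-injective ; symbols-inj = diagonal-symbols-injective }
    where
    open OrthogonalPair (Cyclic.cyclicPair h)
    open Diagonal (Cyclic.cyclicPair h) zero

  -- Prolong a cyclic square of odd order by one transversal; a second, parallel one together with
  -- the new corner cell is a transversal of the result.
  even-order : ∀ h → let m = suc (suc h + suc h) in LatinWithTransversal (m + 1)
  even-order h = record
    { square = carry P ; latin = carry-latin {P} P-latin ; transversal = from ∘ σ ∘ to
    ; columns-inj = λ eq → to-injective (σ-injective (from-injective eq))
    ; symbols-inj = λ {i} {j} eq → to-injective (τ-injective (from-injective
        (trans (sym (carried i)) (trans eq (carried j))))) }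
    where
    m = suc (suc h + suc h)
    O = Cyclic.cyclicPair (suc h)
    1≤m : 1 ≤ m
    1≤m = s≤s z≤n
    corner : Fin 1 → Fin 1 → Fin 1
    corner _ _ = zero
    open OrthogonalPair O
    open Diagonal O (suc zero)
    open Prolongation 1≤m corner O
    open Embedding 1≤m
    open Transport (+↔⊎ {m} {1})
    open Inverse (+↔⊎ {m} {1}) using (to; from)
    P-latin : Latin P
    P-latin = prolongation-latin 1≤m corner O ((λ { _ {zero} {zero} _ → refl }) , (λ { _ {zero} {zero} _ → refl }))
    σ τ : W → W
    σ (inj₁ a)    = inj₁ (Er a (suc zero))
    σ (inj₂ zero) = inj₂ zero
    τ (inj₁ a)    = inj₁ (S a (Er a (suc zero)))
    τ (inj₂ zero) = inj₂ zero
    avoids-first : ∀ a dec → inner a (Er a (suc zero)) dec ≡ inj₁ (S a (Er a (suc zero)))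
    avoids-first a (no _)           = refl
    avoids-first a (yes (zero , p)) = contradiction (trans p (E-Er a (suc zero))) λ ()
    P-σ : ∀ u → P u (σ u) ≡ τ u
    P-σ (inj₁ a)    = avoids-first a (cell? (E a (Er a (suc zero))))
    P-σ (inj₂ zero) = refl
    σ-injective : Inj σ
    σ-injective {inj₁ a}    {inj₁ b}    eq = cong inj₁ (diagonal-injective (inj₁-injective eq))
    σ-injective {inj₁ _}    {inj₂ zero} ()
    σ-injective {inj₂ zero} {inj₁ _}    ()
    σ-injective {inj₂ zero} {inj₂ zero} eq = refl
    τ-injective : Inj τ
    τ-injective {inj₁ a}    {inj₁ b}    eq = cong inj₁ (diagonal-symbols-injective (inj₁-injective eq))
    τ-injective {inj₁ _}    {inj₂ zero} ()
    τ-injective {inj₂ zero} {inj₁ _}    ()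
    τ-injective {inj₂ zero} {inj₂ zero} eq = refl
    carried : ∀ i → carry P i (from (σ (to i))) ≡ from (τ (to i))
    carried i = cong from (trans (cong (P (to i)) (to-from _)) (P-σ (to i)))

  -- From 4 on both parities come from cyclic squares: odd orders directly, even orders by
  -- prolonging one of odd order at least 3, which has a second diagonal to spare.
  latinWithTransversal : ∀ r → LatinWithTransversal (4 + r)
  latinWithTransversal r with even-or-odd r
  ... | h , inj₁ r≡ = subst LatinWithTransversal size (even-order h)
    where
    open ≡-Reasoning
    size : suc (suc h + suc h) + 1 ≡ 4 + r
    size = begin
      suc (suc h + suc h) + 1   ≡⟨ +-comm _ 1 ⟩
      3 + (h + suc h)           ≡⟨ cong (3 +_) (+-suc h h) ⟩
      4 + (h + h)               ≡⟨ cong (4 +_) r≡ ⟨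
      4 + r                     ∎
  ... | h , inj₂ r≡ = subst LatinWithTransversal size (odd-order (2 + h))
    where
    open ≡-Reasoning
    size : suc ((2 + h) + (2 + h)) ≡ 4 + r
    size = begin
      3 + (h + suc (suc h))     ≡⟨ cong (3 +_) (trans (+-suc h (suc h)) (cong suc (+-suc h h))) ⟩
      5 + (h + h)               ≡⟨ cong (4 +_) r≡ ⟨
      4 + r                     ∎

-- The series of e²: distance from rationals and a lower bound for factorials

module Series where
  open LatinSquares using (^-distribʳ-*; even-or-odd)
  open import Data.Nat as ℕ using (ℕ; zero; suc; _+_; _*_; _^_; _∸_; _≤_; _<_; z≤n; s≤s; _!; NonZero; >-nonZero; >-nonZero⁻¹)
  open import Data.Nat.Properties
  open import Data.Nat.Divisibility
  open import Data.Nat.Tactic.RingSolver using (solve-∀)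
  open import Data.Sum using (inj₁; inj₂)
  open import Algebra.Properties.CommutativeSemigroup *-commutativeSemigroup using (x∙yz≈y∙xz; x∙yz≈yx∙z; xy∙z≈xz∙y)

  -- k! Σ_{j≤k} 2^j / j!
  e²-scaled : ℕ → ℕ
  e²-scaled zero    = 1
  e²-scaled (suc k) = suc k * e²-scaled k + 2 ^ suc k

  -- (2i − 1)!!
  oddFactorial : ℕ → ℕ
  oddFactorial zero    = 1
  oddFactorial (suc i) = suc (i + i) * oddFactorial i

  [i+i]! : ∀ i → (i + i) ! ≡ 2 ^ i * (i ! * oddFactorial i)
  [i+i]! zero = refl
  [i+i]! (suc i) = begin
    (suc (i + suc i)) !                                              ≡⟨ cong (λ n → suc n !) (+-suc i i) ⟩
    suc (suc (i + i)) * (suc (i + i) * (i + i) !)                    ≡⟨ cong (λ z → suc (suc (i + i)) * (suc (i + i) * z)) ([i+i]! i) ⟩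
    suc (suc (i + i)) * (suc (i + i) * (2 ^ i * (i ! * oddFactorial i)))  ≡⟨ regroup i (2 ^ i) (i !) (oddFactorial i) ⟩
    2 * 2 ^ i * (suc i * i ! * (suc (i + i) * oddFactorial i))       ∎
    where
    open ≡-Reasoning
    regroup : ∀ i p f o → suc (suc (i + i)) * (suc (i + i) * (p * (f * o))) ≡ 2 * p * (suc i * f * (suc (i + i) * o))
    regroup = solve-∀

  oddFactorial-∣ : ∀ i d → oddFactorial i ∣ oddFactorial (d + i)
  oddFactorial-∣ i zero    = ∣-refl
  oddFactorial-∣ i (suc d) = ∣n⇒∣m*n (suc (d + i + (d + i))) (oddFactorial-∣ i d)

  oddFactorial-mono-∣ : ∀ {i k} → i ≤ k → oddFactorial i ∣ oddFactorial k
  oddFactorial-mono-∣ {i} {k} i≤k = subst (λ n → oddFactorial i ∣ oddFactorial n) (m∸n+n≡m i≤k) (oddFactorial-∣ i (k ∸ i))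

  double : ∀ k → k + k ≡ 2 * k
  double k = cong (k +_) (sym (+-identityʳ k))

  -- For k a power of 2 the 2-adic valuation of k!/j! is at least k - 1 - j.
  TwoAdic : ℕ → Set
  TwoAdic k = ∀ j → j ≤ k → j ! * 2 ^ k ∣ 2 * (k ! * 2 ^ j)

  -- By `[i+i]!` both factorials shed a power of 2, leaving the claim for i and k and a divisibility
  -- of odd factorials. For j = 2i + 1 the additional factor 2i + 1 joins the odd factorial, which
  -- fits because i < k.
  twoAdic-double : ∀ k → TwoAdic k → TwoAdic (k + k)
  twoAdic-double k adic j j≤2k with even-or-odd j
  ... | i , inj₁ refl = subst₂ _∣_ (sym lhs) (sym rhs)
        (*-pres-∣ (*-pres-∣ (adic i i≤k) (oddFactorial-mono-∣ i≤k)) (∣-refl {2 ^ k * 2 ^ i}))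
    where
    open ≡-Reasoning
    i≤k : i ≤ k
    i≤k = *-cancelˡ-≤ 2 (subst₂ _≤_ (double i) (double k) j≤2k)
    lhs-regroup : ∀ p f o q → p * (f * o) * (q * q) ≡ f * q * o * (q * p)
    lhs-regroup = solve-∀
    rhs-regroup : ∀ p f o q → 2 * (q * (f * o) * (p * p)) ≡ 2 * (f * p) * o * (q * p)
    rhs-regroup = solve-∀
    lhs : (i + i) ! * 2 ^ (k + k) ≡ i ! * 2 ^ k * oddFactorial i * (2 ^ k * 2 ^ i)
    lhs = trans (cong₂ _*_ ([i+i]! i) (^-distribˡ-+-* 2 k k)) (lhs-regroup (2 ^ i) (i !) (oddFactorial i) (2 ^ k))
    rhs : 2 * ((k + k) ! * 2 ^ (i + i)) ≡ 2 * (k ! * 2 ^ i) * oddFactorial k * (2 ^ k * 2 ^ i)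
    rhs = trans (cong (2 *_) (cong₂ _*_ ([i+i]! k) (^-distribˡ-+-* 2 i i))) (rhs-regroup (2 ^ i) (k !) (oddFactorial k) (2 ^ k))
  ... | i , inj₂ refl = subst₂ _∣_ (sym lhs) (sym rhs)
        (*-pres-∣ (*-pres-∣ (adic i (<⇒≤ i<k)) (oddFactorial-mono-∣ i<k)) (m∣m*n {2 ^ k * 2 ^ i} 2))
    where
    i<k : i < k
    i<k = *-cancelˡ-< 2 i k (subst₂ _<_ (double i) (double k) j≤2k)
    lhs-regroup : ∀ s p f o q → s * (p * (f * o)) * (q * q) ≡ f * q * (s * o) * (q * p)
    lhs-regroup = solve-∀
    rhs-regroup : ∀ p f o q → 2 * (q * (f * o) * (2 * (p * p))) ≡ 2 * (f * p) * o * (q * p * 2)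
    rhs-regroup = solve-∀
    lhs : suc (i + i) ! * 2 ^ (k + k) ≡ i ! * 2 ^ k * oddFactorial (suc i) * (2 ^ k * 2 ^ i)
    lhs = trans (cong₂ _*_ (cong (suc (i + i) *_) ([i+i]! i)) (^-distribˡ-+-* 2 k k))
      (lhs-regroup (suc (i + i)) (2 ^ i) (i !) (oddFactorial i) (2 ^ k))
    rhs : 2 * ((k + k) ! * 2 ^ suc (i + i)) ≡ 2 * (k ! * 2 ^ i) * oddFactorial k * (2 ^ k * 2 ^ i * 2)
    rhs = trans (cong (2 *_) (cong₂ _*_ ([i+i]! k) (cong (2 *_) (^-distribˡ-+-* 2 i i))))
      (rhs-regroup (2 ^ i) (k !) (oddFactorial k) (2 ^ k))

  twoAdic : ∀ ρ → TwoAdic (2 ^ ρ)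
  twoAdic zero    zero       _         = ∣-refl
  twoAdic zero    (suc zero) (s≤s z≤n) = divides 2 refl
  twoAdic (suc ρ) = subst TwoAdic (double (2 ^ ρ)) (twoAdic-double (2 ^ ρ) (twoAdic ρ))

  -- Every term k! 2^l / l! is divisible by 2^(k-1), hence so is their sum over l ≤ j; the factor
  -- `j !` on both sides clears the denominators.
  e²-scaled-∣ : ∀ k → TwoAdic k → ∀ j → j ≤ k → j ! * 2 ^ k ∣ 2 * (k ! * e²-scaled j)
  e²-scaled-∣ k adic zero    j≤k = adic 0 j≤k
  e²-scaled-∣ k adic (suc j) j≤k = subst₂ _∣_ (sym (*-assoc (suc j) (j !) (2 ^ k))) (sym (split (k !) (suc j) (e²-scaled j) (2 ^ suc j)))
    (∣m∣n⇒∣m+n (*-monoʳ-∣ (suc j) (e²-scaled-∣ k adic j (<⇒≤ j≤k)))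
               (subst (_∣ 2 * (k ! * 2 ^ suc j)) (*-assoc (suc j) (j !) (2 ^ k)) (adic (suc j) j≤k)))
    where
    split : ∀ f j e p → 2 * (f * (j * e + p)) ≡ j * (2 * (f * e)) + 2 * (f * p)
    split = solve-∀

  2^k∣2e²-scaled : ∀ k → TwoAdic k → 2 ^ k ∣ 2 * e²-scaled k
  2^k∣2e²-scaled k adic = *-cancelˡ-∣ (k !) {{k !≢0}}
    (subst (k ! * 2 ^ k ∣_) (x∙yz≈y∙xz 2 (k !) (e²-scaled k)) (e²-scaled-∣ k adic k ≤-refl))

  2^k∣2k! : ∀ k → TwoAdic k → 2 ^ k ∣ 2 * k !
  2^k∣2k! k adic = subst₂ _∣_ (*-identityˡ (2 ^ k)) (cong (2 *_) (*-identityʳ (k !))) (adic 0 z≤n)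

  multiples-gap : ∀ {d a b} → d ∣ a → d ∣ b → a < b → a + d ≤ b
  multiples-gap {d} (divides x refl) (divides y refl) xd<yd =
    ≤-trans (≤-reflexive (+-comm (x * d) d)) (*-monoˡ-≤ d (*-cancelʳ-< d x y xd<yd))

  n<2^n : ∀ n → n < 2 ^ n
  n<2^n zero    = s≤s z≤n
  n<2^n (suc n) = begin-strict
    1 + n                <⟨ +-mono-≤-< (m^n>0 2 n) (n<2^n n) ⟩
    2 ^ n + 2 ^ n        ≡⟨ double (2 ^ n) ⟩
    2 * 2 ^ n            ∎
    where open ≤-Reasoning

  -- With j = suc i, tailBound i / (i j!) = Σ_{l≤j} 2^l / l! + 2^(j+1) / (j! i) bounds the whole series.
  tailBound : ℕ → ℕ
  tailBound i = i * e²-scaled (suc i) + 2 ^ suc (suc i)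

  -- Cleared of denominators: the upper bound `tailBound i` / (i (i + 1)!) decreases as i grows.
  tailBound-step : ∀ i → i * tailBound (suc i) ≤ suc i * suc (suc i) * tailBound i
  tailBound-step i = subst (i * tailBound (suc i) ≤_) (slack i (e²-scaled (suc i)) (2 ^ suc i)) (m≤m+n _ (4 * 2 ^ suc i))
    where
    slack : ∀ i e p → i * (suc i * (suc (suc i) * e + 2 * p) + 2 * (2 * p)) + 4 * p ≡
                      suc i * suc (suc i) * (i * e + 2 * p)
    slack = solve-∀

  module Gap (P Q : ℕ) .{{P≢0 : NonZero P}} (bound : ∀ k → P * e²-scaled k ≤ Q * k !) where
    open ≤-Reasoning

    -- The next partial sum is strictly larger and still obeys the bound.
    bound-strict : ∀ k → P * e²-scaled k < Q * k !
    bound-strict k = *-cancelˡ-< (suc k) _ _ (begin-strict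
      suc k * (P * e²-scaled k)                   <⟨ m<m+n _ (>-nonZero⁻¹ (P * 2 ^ suc k) {{m*n≢0 P (2 ^ suc k) {{P≢0}} {{m^n≢0 2 (suc k)}}}}) ⟩
      suc k * (P * e²-scaled k) + P * 2 ^ suc k   ≡⟨ regroup (suc k) P (e²-scaled k) (2 ^ suc k) ⟩
      P * (suc k * e²-scaled k + 2 ^ suc k)       ≤⟨ bound (suc k) ⟩
      Q * (suc k * k !)                           ≡⟨ x∙yz≈y∙xz Q (suc k) (k !) ⟩
      suc k * (Q * k !)                           ∎)
      where
      regroup : ∀ k P e p → k * (P * e) + P * p ≡ P * (k * e + p)
      regroup = solve-∀

    -- Two different multiples of 2^k are at least 2^k apart.
    margin : ∀ k → TwoAdic k → P * (2 * e²-scaled k) + 2 ^ k ≤ Q * (2 * k !)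
    margin k adic = multiples-gap (∣n⇒∣m*n P (2^k∣2e²-scaled k adic)) (∣n⇒∣m*n Q (2^k∣2k! k adic))
      (subst₂ _<_ (x∙yz≈y∙xz 2 P (e²-scaled k)) (x∙yz≈y∙xz 2 Q (k !)) (*-monoʳ-< 2 (bound-strict k)))

    module _ (i : ℕ) .{{i≢0 : NonZero i}} (adic : TwoAdic (suc i)) (4P<i : 4 * P < i) where

      -- P′ / Q′ is the reciprocal of the upper bound for e² expressed by `tailBound`.
      j P′ Q′ : ℕ
      j  = suc i
      P′ = i * j !
      Q′ = tailBound i

      -- After scaling, the tail costs 4P 2^j while the margin provides i 2^j; hence the condition
      -- 4P < i.
      P*Q′<P′*Q : P * Q′ < P′ * Q
      P*Q′<P′*Q = *-cancelˡ-< 2 _ _ (begin-strict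
        2 * (P * (i * e²-scaled j + 2 * 2 ^ j))        ≡⟨ regroup P i (e²-scaled j) (2 ^ j) ⟩
        i * (P * (2 * e²-scaled j)) + 4 * P * 2 ^ j    <⟨ +-monoʳ-< _ (*-monoˡ-< (2 ^ j) {{m^n≢0 2 j}} 4P<i) ⟩
        i * (P * (2 * e²-scaled j)) + i * 2 ^ j        ≡⟨ *-distribˡ-+ i _ (2 ^ j) ⟨
        i * (P * (2 * e²-scaled j) + 2 ^ j)            ≤⟨ *-monoʳ-≤ i (margin j adic) ⟩
        i * (Q * (2 * j !))                            ≡⟨ swap i Q (j !) ⟩
        2 * (i * j ! * Q)                              ∎)
        where
        regroup : ∀ P i e p → 2 * (P * (i * e + 2 * p)) ≡ i * (P * (2 * e)) + 4 * P * p
        regroup = solve-∀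
        swap : ∀ i Q f → i * (Q * (2 * f)) ≡ 2 * (i * f * Q)
        swap = solve-∀

      tail : ∀ d → P′ * tailBound (d + i) ≤ Q′ * ((d + i) * suc (d + i) !)
      tail zero = ≤-reflexive (*-comm P′ Q′)
      tail (suc d) = *-cancelˡ-≤ l {{l≢0}} (begin
        l * (P′ * tailBound (suc l))                      ≡⟨ x∙yz≈y∙xz l P′ (tailBound (suc l)) ⟩
        P′ * (l * tailBound (suc l))                      ≤⟨ *-monoʳ-≤ P′ (tailBound-step l) ⟩
        P′ * (suc l * suc (suc l) * tailBound l)          ≡⟨ x∙yz≈y∙xz P′ (suc l * suc (suc l)) (tailBound l) ⟩
        suc l * suc (suc l) * (P′ * tailBound l)          ≤⟨ *-monoʳ-≤ (suc l * suc (suc l)) (tail d) ⟩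
        suc l * suc (suc l) * (Q′ * (l * suc l !))        ≡⟨ regroup (suc l) (suc (suc l)) Q′ l (suc l !) ⟩
        l * (Q′ * (suc l * (suc (suc l) * suc l !)))      ∎)
        where
        l = d + i
        l≢0 : NonZero l
        l≢0 = >-nonZero (≤-trans (>-nonZero⁻¹ i) (m≤n+m i d))
        regroup : ∀ a b q l f → a * b * (q * (l * f)) ≡ l * (q * (a * (b * f)))
        regroup = solve-∀

      far : ∀ d → P′ * e²-scaled (suc (d + i)) ≤ Q′ * suc (d + i) !
      far d = *-cancelˡ-≤ l {{l≢0}} (begin
        l * (P′ * e²-scaled (suc l))     ≡⟨ x∙yz≈y∙xz l P′ (e²-scaled (suc l)) ⟩
        P′ * (l * e²-scaled (suc l))     ≤⟨ *-monoʳ-≤ P′ (m≤m+n _ _) ⟩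
        P′ * tailBound l                 ≤⟨ tail d ⟩
        Q′ * (l * suc l !)               ≡⟨ x∙yz≈y∙xz Q′ l (suc l !) ⟩
        l * (Q′ * suc l !)               ∎)
        where
        l = d + i
        l≢0 : NonZero l
        l≢0 = >-nonZero (≤-trans (>-nonZero⁻¹ i) (m≤n+m i d))

      mono : ∀ N d → e²-scaled N * (d + N) ! ≤ e²-scaled (d + N) * N !
      mono N zero    = ≤-refl
      mono N (suc d) = begin
        e²-scaled N * (suc (d + N) * (d + N) !)        ≡⟨ x∙yz≈y∙xz (e²-scaled N) (suc (d + N)) ((d + N) !) ⟩
        suc (d + N) * (e²-scaled N * (d + N) !)        ≤⟨ *-monoʳ-≤ (suc (d + N)) (mono N d) ⟩
        suc (d + N) * (e²-scaled (d + N) * N !)        ≡⟨ *-assoc (suc (d + N)) (e²-scaled (d + N)) (N !) ⟨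
        suc (d + N) * e²-scaled (d + N) * N !          ≤⟨ *-monoˡ-≤ (N !) (m≤m+n (suc (d + N) * e²-scaled (d + N)) (2 ^ suc (d + N))) ⟩
        e²-scaled (suc (d + N)) * N !                  ∎

      -- Partial sums increase, so N may first be raised past i, where the tail bound applies.
      bound′ : ∀ N → P′ * e²-scaled N ≤ Q′ * N !
      bound′ N = *-cancelʳ-≤ _ _ ((suc i + N) !) {{(suc i + N) !≢0}} (begin
        P′ * e²-scaled N * (suc i + N) !       ≡⟨ *-assoc P′ (e²-scaled N) ((suc i + N) !) ⟩
        P′ * (e²-scaled N * (suc i + N) !)     ≤⟨ *-monoʳ-≤ P′ (mono N (suc i)) ⟩
        P′ * (e²-scaled (suc i + N) * N !)     ≡⟨ *-assoc P′ (e²-scaled (suc i + N)) (N !) ⟨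
        P′ * e²-scaled (suc i + N) * N !       ≤⟨ *-monoˡ-≤ (N !) (subst (λ l → P′ * e²-scaled (suc l) ≤ Q′ * suc l !) (+-comm N i) (far N)) ⟩
        Q′ * (suc i + N) ! * N !               ≡⟨ xy∙z≈xz∙y Q′ ((suc i + N) !) (N !) ⟩
        Q′ * N ! * (suc i + N) !               ∎)

    Improved : Set
    Improved = ∃ λ P′ → ∃ λ Q′ → P * Q′ < P′ * Q × (∀ N → P′ * e²-scaled N ≤ Q′ * N !)

    improved-at : ∀ k → TwoAdic k → suc (4 * P) < k → Improved
    improved-at (suc i) adic (s≤s 4P<i) =
      P′ i adic 4P<i , Q′ i adic 4P<i , P*Q′<P′*Q i adic 4P<i , bound′ i adic 4P<i
      where instance
      i≢0 : NonZero i
      i≢0 = >-nonZero (≤-trans (s≤s z≤n) 4P<i)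

    improved : Improved
    -- A power of 2, as the divisibilities require, and larger than its exponent 4P + 1.
    improved = improved-at (2 ^ suc (4 * P)) (twoAdic (suc (4 * P))) (n<2^n (suc (4 * P)))

  -- N^n n! Σ_{j≤n} (y/N)^j / j!
  expScaled : ℕ → ℕ → ℕ → ℕ
  expScaled N y zero    = 1
  expScaled N y (suc n) = suc n * N * expScaled N y n + y ^ suc n

  bernoulli : ∀ x y m → y ^ m + m * x * y ^ ℕ.pred m ≤ (x + y) ^ m
  bernoulli x y zero          = ≤-refl
  bernoulli x y (suc zero)    = ≤-reflexive (one x y)
    where
    one : ∀ x y → y * 1 + 1 * x * 1 ≡ (x + y) * 1
    one = solve-∀
  bernoulli x y (suc (suc m)) = begin
    y * (y * y ^ m) + (2 + m) * x * (y * y ^ m)                              ≤⟨ m≤m+n _ (suc m * (x * (x * y ^ m))) ⟩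
    y * (y * y ^ m) + (2 + m) * x * (y * y ^ m) + suc m * (x * (x * y ^ m))  ≡⟨ expand x y m (y ^ m) ⟩
    (x + y) * (y * y ^ m + suc m * x * y ^ m)                                ≤⟨ *-monoʳ-≤ (x + y) (bernoulli x y (suc m)) ⟩
    (x + y) * (x + y) ^ suc m                                                ∎
    where
    open ≤-Reasoning
    expand : ∀ x y m p → y * (y * p) + (2 + m) * x * (y * p) + suc m * (x * (x * p)) ≡ (x + y) * (y * p + suc m * x * p)
    expand = solve-∀

  -- Compares coefficients in (1 + x/N) Σ_{j≤l} (nx/N)^j / j! ≤ Σ_{j≤l+1} ((n+1)x/N)^j / j!.
  expScaled-step : ∀ N x n l →
    expScaled N (n * x) (suc l) + suc l * x * expScaled N (n * x) l ≤ expScaled N (suc n * x) (suc l)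
  expScaled-step N x n zero = ≤-reflexive (base N x n)
    where
    base : ∀ N x n → (1 * N * 1 + n * x * 1) + 1 * x * 1 ≡ 1 * N * 1 + (x + n * x) * 1
    base = solve-∀
  expScaled-step N x n (suc l) = begin
    (2 + l) * N * expScaled N y (suc l) + y ^ (2 + l) + (2 + l) * x * expScaled N y (suc l)
      ≡⟨ regroup N x y l (expScaled N y l) (y ^ l) ⟩
    (2 + l) * N * (expScaled N y (suc l) + suc l * x * expScaled N y l) + (y ^ (2 + l) + (2 + l) * x * y ^ suc l)
      ≤⟨ +-mono-≤ (*-monoʳ-≤ ((2 + l) * N) (expScaled-step N x n l)) (bernoulli x y (2 + l)) ⟩
    (2 + l) * N * expScaled N (suc n * x) (suc l) + (suc n * x) ^ (2 + l) ∎
    where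
    open ≤-Reasoning
    y = n * x
    regroup : ∀ N x y l e p → (2 + l) * N * (suc l * N * e + y * p) + y * (y * p) + (2 + l) * x * (suc l * N * e + y * p) ≡
      (2 + l) * N * (suc l * N * e + y * p + suc l * x * e) + (y * (y * p) + (2 + l) * x * (y * p))
    regroup = solve-∀

  -- This is (1 + x/N)^n ≤ Σ_{j≤n} (nx/N)^j / j!. One more factor 1 + x/N is absorbed by moving the
  -- argument from nx/N to (n+1)x/N, so no binomial expansion is needed.
  binomial-≤ : ∀ N x n → (N + x) ^ n * n ! ≤ expScaled N (n * x) n
  binomial-≤ N x zero    = ≤-refl
  binomial-≤ N x (suc n) = begin
    (N + x) * (N + x) ^ n * (suc n * n !)              ≡⟨ regroup (N + x) ((N + x) ^ n) (suc n) (n !) ⟩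
    suc n * (N + x) * ((N + x) ^ n * n !)              ≤⟨ *-monoʳ-≤ (suc n * (N + x)) (binomial-≤ N x n) ⟩
    suc n * (N + x) * expScaled N (n * x) n            ≡⟨ split (suc n) N x (expScaled N (n * x) n) ⟩
    suc n * N * expScaled N (n * x) n + suc n * x * expScaled N (n * x) n
      ≤⟨ +-monoˡ-≤ (suc n * x * expScaled N (n * x) n) (m≤m+n _ _) ⟩
    expScaled N (n * x) (suc n) + suc n * x * expScaled N (n * x) n   ≤⟨ expScaled-step N x n n ⟩
    expScaled N (suc n * x) (suc n)                    ∎
    where
    open ≤-Reasoning
    regroup : ∀ a b c d → a * b * (c * d) ≡ c * a * (b * d)
    regroup = solve-∀
    split : ∀ a N x e → a * (N + x) * e ≡ a * N * e + a * x * e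
    split = solve-∀

  expScaled-e² : ∀ N n → expScaled N (N * 2) n ≡ N ^ n * e²-scaled n
  expScaled-e² N zero    = refl
  expScaled-e² N (suc n) = begin
    suc n * N * expScaled N (N * 2) n + (N * 2) ^ suc n              ≡⟨ cong₂ (λ a b → suc n * N * a + b) (expScaled-e² N n) (^-distribʳ-* (suc n) N 2) ⟩
    suc n * N * (N ^ n * e²-scaled n) + N ^ suc n * 2 ^ suc n        ≡⟨ regroup (suc n) N (N ^ n) (e²-scaled n) (2 ^ suc n) ⟩
    N ^ suc n * (suc n * e²-scaled n + 2 ^ suc n)                    ∎
    where
    open ≡-Reasoning
    regroup : ∀ a N p e q → a * N * (p * e) + N * p * q ≡ N * p * (a * e + q)
    regroup = solve-∀

  module FactorialBound (P Q : ℕ) (bound : ∀ N → P * e²-scaled N ≤ Q * N !) where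
    open ≤-Reasoning

    [1+2/N]^N : ∀ N → P * (N + 2) ^ N ≤ Q * N ^ N
    [1+2/N]^N N = *-cancelʳ-≤ _ _ (N !) {{N !≢0}} (begin
      P * (N + 2) ^ N * N !          ≡⟨ *-assoc P _ _ ⟩
      P * ((N + 2) ^ N * N !)        ≤⟨ *-monoʳ-≤ P (binomial-≤ N 2 N) ⟩
      P * expScaled N (N * 2) N      ≡⟨ cong (P *_) (expScaled-e² N N) ⟩
      P * (N ^ N * e²-scaled N)      ≡⟨ x∙yz≈y∙xz P (N ^ N) (e²-scaled N) ⟩
      N ^ N * (P * e²-scaled N)      ≤⟨ *-monoʳ-≤ (N ^ N) (bound N) ⟩
      N ^ N * (Q * N !)              ≡⟨ x∙yz≈yx∙z (N ^ N) Q (N !) ⟩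
      Q * N ^ N * N !                ∎)

    square-^ : ∀ a j → (a * a) ^ j ≡ a ^ (2 * j)
    square-^ a j = trans (cong (λ z → (a * z) ^ j) (sym (*-identityʳ a))) (^-*-assoc a 2 j)

    -- The case N = 2j, where 1 + 2/N becomes 1 + 1/j, after cancelling 2^(2j).
    [1+1/j]^2j : ∀ j → P * (suc j * suc j) ^ j ≤ Q * (j * j) ^ j
    [1+1/j]^2j j = *-cancelˡ-≤ (2 ^ (2 * j)) {{m^n≢0 2 (2 * j)}} (begin
      2 ^ (2 * j) * (P * (suc j * suc j) ^ j)    ≡⟨ lift P (suc j) ⟩
      P * (2 * suc j) ^ (2 * j)                  ≡⟨ cong (λ z → P * z ^ (2 * j)) (trans (*-distribˡ-+ 2 1 j) (+-comm 2 (2 * j))) ⟩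
      P * (2 * j + 2) ^ (2 * j)                  ≤⟨ [1+2/N]^N (2 * j) ⟩
      Q * (2 * j) ^ (2 * j)                      ≡⟨ lift Q j ⟨
      2 ^ (2 * j) * (Q * (j * j) ^ j)            ∎)
      where
      lift : ∀ P a → 2 ^ (2 * j) * (P * (a * a) ^ j) ≡ P * (2 * a) ^ (2 * j)
      lift P a = trans (x∙yz≈y∙xz (2 ^ (2 * j)) P _) (cong (P *_)
        (trans (cong (2 ^ (2 * j) *_) (square-^ a j)) (sym (^-distribʳ-* (2 * j) 2 a))))

    -- From m = j to m = j + 1 the quotient m^(2m) / (m!)² grows by the factor (1 + 1/j)^(2j), at
    -- most Q / P. Squaring the factorial lets e² serve directly, without estimates for e.
    factorial-bound : ∀ m → (P * (m * m)) ^ m ≤ Q ^ m * (m ! * m !)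
    factorial-bound zero    = ≤-refl
    factorial-bound (suc j) = begin
      P * (suc j * suc j) * (P * (suc j * suc j)) ^ j
        ≡⟨ cong (P * (suc j * suc j) *_) (^-distribʳ-* j P (suc j * suc j)) ⟩
      P * (suc j * suc j) * (P ^ j * (suc j * suc j) ^ j)
        ≡⟨ regroup P (suc j) (P ^ j) ((suc j * suc j) ^ j) ⟩
      suc j * suc j * (P ^ j * (P * (suc j * suc j) ^ j))
        ≤⟨ *-monoʳ-≤ (suc j * suc j) (*-monoʳ-≤ (P ^ j) ([1+1/j]^2j j)) ⟩
      suc j * suc j * (P ^ j * (Q * (j * j) ^ j))
        ≡⟨ cong (suc j * suc j *_) (trans (x∙yz≈y∙xz (P ^ j) Q _) (cong (Q *_) (sym (^-distribʳ-* j P (j * j))))) ⟩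
      suc j * suc j * (Q * (P * (j * j)) ^ j)
        ≤⟨ *-monoʳ-≤ (suc j * suc j) (*-monoʳ-≤ Q (factorial-bound j)) ⟩
      suc j * suc j * (Q * (Q ^ j * (j ! * j !)))
        ≡⟨ regroup′ (suc j) Q (Q ^ j) (j !) ⟩
      Q * Q ^ j * (suc j * j ! * (suc j * j !)) ∎
      where
      regroup : ∀ P a p b → P * (a * a) * (p * b) ≡ a * a * (p * (P * b))
      regroup = solve-∀
      regroup′ : ∀ a Q q f → a * a * (Q * (q * (f * f))) ≡ Q * q * (a * f * (a * f))
      regroup′ = solve-∀

-- Elementary estimates and the combination of the counts

module Inequalities where
  open LatinSquares using (^-distribʳ-*)
  open Series using (bernoulli; n<2^n)
  open import Data.Nat using (ℕ; zero; suc; _+_; _*_; _^_; _≤_; _!; NonZero)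
  open import Data.Nat.Properties
  open import Data.Nat.DivMod using (_/_; _%_; m≡m%n+[m/n]*n; m%n<n; m*n/n≡m; /-monoˡ-≤)
  open import Data.Nat.Tactic.RingSolver using (solve-∀)
  open import Algebra.Properties.CommutativeSemigroup *-commutativeSemigroup using (xy∙z≈xz∙y)
  open ≤-Reasoning

  2uᵘ≤[1+u]ᵘ : ∀ u .{{_ : NonZero u}} → 2 * u ^ u ≤ suc u ^ u
  2uᵘ≤[1+u]ᵘ (suc u) = begin
    2 * (suc u * suc u ^ u)                            ≡⟨ regroup (suc u) (suc u ^ u) ⟩
    suc u * suc u ^ u + suc u * 1 * suc u ^ u          ≤⟨ bernoulli 1 (suc u) (suc u) ⟩
    (1 + suc u) ^ suc u                                ∎
    where
    regroup : ∀ u p → 2 * (u * p) ≡ u * p + u * 1 * p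
    regroup = solve-∀

  module Growth (C p u : ℕ) .{{C≢0 : NonZero C}} .{{p≢0 : NonZero p}} .{{u≢0 : NonZero u}} where

    D t₁ : ℕ
    D  = u * (2 * p)
    t₁ = C * D * D

    D≢0 : NonZero D
    D≢0 = m*n≢0 u (2 * p) {{u≢0}} {{m*n≢0 2 p {{_}} {{p≢0}}}}

    -- Since (1 + 1/u)^u ≥ 2, the choice h = t / D with D = 2pu gives (1 + 1/u)^t ≥ 4^(hp). On the
    -- other side C(t + 1) ≤ CD(h + 1) ≤ 2^h 2^h as soon as CD ≤ h, which t ≥ CD² ensures.
    growth : ∀ t → t₁ ≤ t → (C * suc t) ^ p * u ^ t ≤ suc u ^ t
    growth t t₁≤t = begin
      (C * suc t) ^ p * u ^ t                          ≤⟨ *-monoˡ-≤ (u ^ t) (^-monoˡ-≤ p C[1+t]≤) ⟩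
      (2 ^ h * 2 ^ h) ^ p * u ^ t                      ≡⟨ cong₂ _*_ 2^h-power (cong (u ^_) t≡) ⟩
      2 ^ (2 * p * h) * u ^ (u * (2 * p * h) + w)      ≡⟨ cong (2 ^ (2 * p * h) *_) (trans (^-distribˡ-+-* u (u * (2 * p * h)) w) (cong (_* u ^ w) (sym (^-*-assoc u u (2 * p * h))))) ⟩
      2 ^ (2 * p * h) * ((u ^ u) ^ (2 * p * h) * u ^ w) ≡⟨ *-assoc (2 ^ (2 * p * h)) ((u ^ u) ^ (2 * p * h)) (u ^ w) ⟨
      2 ^ (2 * p * h) * (u ^ u) ^ (2 * p * h) * u ^ w  ≡⟨ cong (_* u ^ w) (^-distribʳ-* (2 * p * h) 2 (u ^ u)) ⟨
      (2 * u ^ u) ^ (2 * p * h) * u ^ w                ≤⟨ *-mono-≤ (^-monoˡ-≤ (2 * p * h) (2uᵘ≤[1+u]ᵘ u)) (^-monoˡ-≤ w (n≤1+n u)) ⟩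
      (suc u ^ u) ^ (2 * p * h) * suc u ^ w            ≡⟨ cong (_* suc u ^ w) (^-*-assoc (suc u) u (2 * p * h)) ⟩
      suc u ^ (u * (2 * p * h)) * suc u ^ w            ≡⟨ ^-distribˡ-+-* (suc u) (u * (2 * p * h)) w ⟨
      suc u ^ (u * (2 * p * h) + w)                    ≡⟨ cong (suc u ^_) t≡ ⟨
      suc u ^ t                                        ∎
      where
      instance _ = D≢0
      h w : ℕ
      h = t / D
      w = t % D
      CD≤h : C * D ≤ h
      CD≤h = ≤-trans (≤-reflexive (sym (m*n/n≡m (C * D) D))) (/-monoˡ-≤ D t₁≤t)
      t≡′ : t ≡ w + h * D
      t≡′ = m≡m%n+[m/n]*n t D
      t≡ : t ≡ u * (2 * p * h) + w
      t≡ = trans t≡′ (regroup w h u p)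
        where
        regroup : ∀ w h u p → w + h * (u * (2 * p)) ≡ u * (2 * p * h) + w
        regroup = solve-∀
      C[1+t]≤ : C * suc t ≤ 2 ^ h * 2 ^ h
      C[1+t]≤ = begin
        C * suc t              ≡⟨ cong (λ z → C * suc z) t≡′ ⟩
        C * (suc w + h * D)    ≤⟨ *-monoʳ-≤ C (+-monoˡ-≤ (h * D) (m%n<n t D)) ⟩
        C * (D + h * D)        ≡⟨ *-assoc C (suc h) D ⟨
        C * suc h * D          ≡⟨ xy∙z≈xz∙y C (suc h) D ⟩
        C * D * suc h          ≤⟨ *-mono-≤ (≤-trans CD≤h (<⇒≤ (n<2^n h))) (n<2^n h) ⟩
        2 ^ h * 2 ^ h          ∎
      2^h-power : (2 ^ h * 2 ^ h) ^ p ≡ 2 ^ (2 * p * h)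
      2^h-power = trans (cong (_^ p) (sym (^-distribˡ-+-* 2 h h))) (trans (^-*-assoc 2 (h + h) p) (cong (2 ^_) (regroup h p)))
        where
        regroup : ∀ h p → (h + h) * p ≡ 2 * p * h
        regroup = solve-∀

  factorial-quotient : ∀ t m → (t + m) ! ≤ (t + m) ^ t * m !
  factorial-quotient zero    m = ≤-reflexive (sym (*-identityˡ (m !)))
  factorial-quotient (suc t) m = begin
    suc (t + m) * (t + m) !                        ≤⟨ *-monoʳ-≤ (suc (t + m)) (factorial-quotient t m) ⟩
    suc (t + m) * ((t + m) ^ t * m !)              ≤⟨ *-monoʳ-≤ (suc (t + m)) (*-monoˡ-≤ (m !) (^-monoˡ-≤ t (n≤1+n (t + m)))) ⟩
    suc (t + m) * (suc (t + m) ^ t * m !)          ≡⟨ *-assoc (suc (t + m)) (suc (t + m) ^ t) (m !) ⟨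
    suc (t + m) * suc (t + m) ^ t * m !            ∎

  module Counting
    (s t m m′ k g A W N p q : ℕ) (m!-bound : m ! ≤ m ^ t * m′ !) (m≡ : m ≡ s * t)
    (A≡ : A ≡ W ^ k * ((m !) ^ k * (m !) ^ k))
    (count : A * (g ^ t * (m′ ! * m′ !)) ^ (k * s) ≤ (m ! * m !) ^ (k * s) * N)
    (words : s ^ (t * s) ≤ suc t ^ (s * s) * W)
    (stirling : (p * (m * m)) ^ m ≤ q ^ m * (m ! * m !))
    .{{m≢0 : NonZero m}} where

    B n₀ e : ℕ
    B  = k * s
    n₀ = t * B
    e  = s * s * k

    -- Per block, (m′! / m!)² is at least m^(-2t), so all factorials of m′ cancel.
    blocks : A * g ^ n₀ ≤ (m * m) ^ n₀ * N
    blocks = *-cancelʳ-≤ (A * g ^ n₀) ((m * m) ^ n₀ * N) F^B {{m^n≢0 F B {{m′ !* m′ !≢0}}}} (begin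
      A * g ^ n₀ * F^B                                ≡⟨ *-assoc A (g ^ n₀) F^B ⟩
      A * (g ^ n₀ * F^B)                              ≡⟨ cong (λ z → A * (z * F^B)) (^-*-assoc g t B) ⟨
      A * ((g ^ t) ^ B * F^B)                         ≡⟨ cong (A *_) (^-distribʳ-* B (g ^ t) F) ⟨
      A * (g ^ t * F) ^ B                             ≤⟨ count ⟩
      (m ! * m !) ^ B * N                             ≤⟨ *-monoˡ-≤ N (^-monoˡ-≤ B (*-mono-≤ m!-bound m!-bound)) ⟩
      (m ^ t * m′ ! * (m ^ t * m′ !)) ^ B * N         ≡⟨ cong (λ z → z ^ B * N) ([m*n]*[o*p]≡[m*o]*[n*p] (m ^ t) (m′ !) (m ^ t) (m′ !)) ⟩
      (m ^ t * m ^ t * F) ^ B * N                     ≡⟨ cong (λ z → (z * F) ^ B * N) (^-distribʳ-* t m m) ⟨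
      ((m * m) ^ t * F) ^ B * N                       ≡⟨ cong (_* N) (^-distribʳ-* B ((m * m) ^ t) F) ⟩
      ((m * m) ^ t) ^ B * F^B * N                     ≡⟨ cong (λ z → z * F^B * N) (^-*-assoc (m * m) t B) ⟩
      (m * m) ^ n₀ * F^B * N                          ≡⟨ xy∙z≈xz∙y ((m * m) ^ n₀) F^B N ⟩
      (m * m) ^ n₀ * N * F^B                          ∎)
      where
      F F^B : ℕ
      F   = m′ ! * m′ !
      F^B = F ^ B

    words-power : s ^ n₀ ≤ suc t ^ e * W ^ k
    words-power = begin
      s ^ n₀                           ≡⟨ cong (s ^_) (regroup t k s) ⟩
      s ^ (t * s * k)                  ≡⟨ ^-*-assoc s (t * s) k ⟨
      (s ^ (t * s)) ^ k                ≤⟨ ^-monoˡ-≤ k words ⟩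
      (suc t ^ (s * s) * W) ^ k        ≡⟨ ^-distribʳ-* k (suc t ^ (s * s)) W ⟩
      (suc t ^ (s * s)) ^ k * W ^ k    ≡⟨ cong (_* W ^ k) (^-*-assoc (suc t) (s * s) k) ⟩
      suc t ^ e * W ^ k                ∎
      where
      regroup : ∀ t k s → t * (k * s) ≡ t * s * k
      regroup = solve-∀

    m*k≡n₀ : m * k ≡ n₀
    m*k≡n₀ = trans (cong (_* k) m≡) (regroup s t k)
      where
      regroup : ∀ s t k → s * t * k ≡ t * (k * s)
      regroup = solve-∀

    stirling-power : (p * (m * m)) ^ n₀ ≤ q ^ n₀ * ((m !) ^ k * (m !) ^ k)
    stirling-power = begin
      (p * (m * m)) ^ n₀                   ≡⟨ cong ((p * (m * m)) ^_) m*k≡n₀ ⟨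
      (p * (m * m)) ^ (m * k)              ≡⟨ ^-*-assoc (p * (m * m)) m k ⟨
      ((p * (m * m)) ^ m) ^ k              ≤⟨ ^-monoˡ-≤ k stirling ⟩
      (q ^ m * (m ! * m !)) ^ k            ≡⟨ ^-distribʳ-* k (q ^ m) (m ! * m !) ⟩
      (q ^ m) ^ k * (m ! * m !) ^ k        ≡⟨ cong₂ _*_ (trans (^-*-assoc q m k) (cong (q ^_) m*k≡n₀)) (^-distribʳ-* k (m !) (m !)) ⟩
      q ^ n₀ * ((m !) ^ k * (m !) ^ k)     ∎

    -- The m² per cell gained from the factorials cancels the m² lost in `blocks`. What stays is s
    -- from the words times g from the greedy choice; for g = (s - 2)t this is n up to a factor 1 -
    -- O(1/s).
    counting : (p * (s * g)) ^ n₀ ≤ q ^ n₀ * (suc t ^ e * N)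
    counting = *-cancelʳ-≤ ((p * (s * g)) ^ n₀) (q ^ n₀ * (suc t ^ e * N)) M^n₀ {{m^n≢0 M n₀ {{m*n≢0 m m {{m≢0}} {{m≢0}}}}}} (begin
      (p * (s * g)) ^ n₀ * M^n₀                              ≡⟨ cong (_* M^n₀) (trans (^-distribʳ-* n₀ p (s * g)) (cong (p ^ n₀ *_) (^-distribʳ-* n₀ s g))) ⟩
      p ^ n₀ * (s ^ n₀ * g ^ n₀) * M^n₀                      ≡⟨ regroup₁ (p ^ n₀) (s ^ n₀) (g ^ n₀) M^n₀ ⟩
      p ^ n₀ * M^n₀ * s ^ n₀ * g ^ n₀                        ≡⟨ cong (λ z → z * s ^ n₀ * g ^ n₀) (^-distribʳ-* n₀ p M) ⟨
      (p * M) ^ n₀ * s ^ n₀ * g ^ n₀                         ≤⟨ *-monoˡ-≤ (g ^ n₀) (*-mono-≤ stirling-power words-power) ⟩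
      q ^ n₀ * ((m !) ^ k * (m !) ^ k) * (suc t ^ e * W ^ k) * g ^ n₀   ≡⟨ regroup₂ (q ^ n₀) ((m !) ^ k * (m !) ^ k) (suc t ^ e) (W ^ k) (g ^ n₀) ⟩
      q ^ n₀ * (suc t ^ e * (W ^ k * ((m !) ^ k * (m !) ^ k) * g ^ n₀)) ≡⟨ cong (λ z → q ^ n₀ * (suc t ^ e * (z * g ^ n₀))) A≡ ⟨
      q ^ n₀ * (suc t ^ e * (A * g ^ n₀))                    ≤⟨ *-monoʳ-≤ (q ^ n₀) (*-monoʳ-≤ (suc t ^ e) blocks) ⟩
      q ^ n₀ * (suc t ^ e * (M^n₀ * N))                      ≡⟨ regroup₃ (q ^ n₀) (suc t ^ e) M^n₀ N ⟩
      q ^ n₀ * (suc t ^ e * N) * M^n₀                        ∎)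
      where
      M M^n₀ : ℕ
      M = m * m
      M^n₀ = M ^ n₀
      regroup₁ : ∀ p s g M → p * (s * g) * M ≡ p * M * s * g
      regroup₁ = solve-∀
      regroup₂ : ∀ q f t W g → q * f * (t * W) * g ≡ q * (t * (W * f * g))
      regroup₂ = solve-∀
      regroup₃ : ∀ q t M N → q * (t * (M * N)) ≡ q * (t * N) * M
      regroup₃ = solve-∀

  -- T and (P n)^r, polynomial in n, are absorbed by the gap factor (1 + 1/u)^n₀ between P/Q and p/q.
  combine-bounds : ∀ P Q p q u n n₀ r T v N .{{_ : NonZero u}} .{{_ : NonZero q}} .{{_ : NonZero T}} .{{_ : NonZero Q}} →
    n ≡ n₀ + r → (p * v) ^ n₀ ≤ q ^ n₀ * (T * N) →
    P * n * q * suc u ≤ u * (Q * (p * v)) → (P * n) ^ r * T * u ^ n₀ ≤ suc u ^ n₀ →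
    (P * n) ^ n ≤ Q ^ n * N
  combine-bounds P Q p q u n n₀ r T v N {{u≢0}} {{q≢0}} {{T≢0}} {{Q≢0}} n≡ counting linear growth = ≤-trans core
      (*-monoˡ-≤ N (^-monoʳ-≤ Q (subst (n₀ ≤_) (sym n≡) (m≤m+n n₀ r))))
    where
    x Z : ℕ
    x = P * n
    Z = u ^ n₀ * q ^ n₀ * T
    Z≢0 : NonZero Z
    Z≢0 = m*n≢0 _ T {{m*n≢0 _ _ {{m^n≢0 u n₀ {{u≢0}}}} {{m^n≢0 q n₀ {{q≢0}}}}}} {{T≢0}}
    core : x ^ n ≤ Q ^ n₀ * N
    core = *-cancelʳ-≤ (x ^ n) (Q ^ n₀ * N) Z {{Z≢0}} (begin
      x ^ n * Z                                       ≡⟨ cong (λ l → x ^ l * Z) n≡ ⟩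
      x ^ (n₀ + r) * Z                                ≡⟨ cong (_* Z) (^-distribˡ-+-* x n₀ r) ⟩
      x ^ n₀ * x ^ r * (u ^ n₀ * q ^ n₀ * T)          ≡⟨ regroup₁ (x ^ n₀) (x ^ r) (u ^ n₀) (q ^ n₀) T ⟩
      x ^ n₀ * q ^ n₀ * (x ^ r * T * u ^ n₀)          ≤⟨ *-monoʳ-≤ (x ^ n₀ * q ^ n₀) growth ⟩
      x ^ n₀ * q ^ n₀ * suc u ^ n₀                    ≡⟨ trans (^-distribʳ-* n₀ (x * q) (suc u)) (cong (_* suc u ^ n₀) (^-distribʳ-* n₀ x q)) ⟨
      (x * q * suc u) ^ n₀                            ≤⟨ ^-monoˡ-≤ n₀ linear ⟩
      (u * (Q * (p * v))) ^ n₀                        ≡⟨ trans (^-distribʳ-* n₀ u _) (cong (u ^ n₀ *_) (^-distribʳ-* n₀ Q (p * v))) ⟩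
      u ^ n₀ * (Q ^ n₀ * (p * v) ^ n₀)                ≤⟨ *-monoʳ-≤ (u ^ n₀) (*-monoʳ-≤ (Q ^ n₀) counting) ⟩
      u ^ n₀ * (Q ^ n₀ * (q ^ n₀ * (T * N)))          ≡⟨ regroup₂ (u ^ n₀) (Q ^ n₀) (q ^ n₀) T N ⟩
      Q ^ n₀ * N * Z                                  ∎)
      where
      regroup₁ : ∀ x y u q T → x * y * (u * q * T) ≡ x * q * (y * T * u)
      regroup₁ = solve-∀
      regroup₂ : ∀ u Q q T N → u * (Q * (q * (T * N))) ≡ Q * N * (u * q * T)
      regroup₂ = solve-∀

-- Choice of parameters for large n

module Asymptotics where
  open LatinSquares
  open Series
  open Inequalities
  open import Data.Nat as ℕ using (ℕ; suc; _+_; _*_; _^_; _∸_; _≤_; _<_; z≤n; s≤s; _!; NonZero; >-nonZero; >-nonZero⁻¹)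
  open import Data.Nat.Properties
  open import Data.Nat.DivMod using (_/_; _%_; m≡m%n+[m/n]*n; m%n<n; m*n/n≡m; /-monoˡ-≤)
  open import Data.Nat.Tactic.RingSolver using (solve-∀)

  orthogonalPair : ∀ {n} h → n ≡ suc (h + h) → OrthogonalPair n
  orthogonalPair h n≡ = subst OrthogonalPair (sym n≡) (Cyclic.cyclicPair h)

  HasSquare : (P Q n : ℕ) → Set
  HasSquare P Q n = Σ (Fin n → Fin n → Fin n) λ L → IsLatinSquare n L ×
    Σ ℕ λ N → (P * n) ^ n ≤ Q ^ n * N × HasAtLeastTransversals n L N

  square-of-order : ∀ (s₂ t ρ : ℕ) .{{_ : NonZero t}} → let s = suc (suc s₂) ; k = suc (suc s) ; m = s * t ; r = 4 + ρ ; n = k * m + r in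
    r ≤ m → OrthogonalPair s → OrthogonalPair k → OrthogonalPair m →
    ∀ P Q p q u .{{_ : NonZero Q}} .{{_ : NonZero q}} .{{_ : NonZero u}} → (∀ N → p * e²-scaled N ≤ q * N !) →
    P * n * q * suc u ≤ u * (Q * (p * (s * (s₂ * t)))) →
    (P * n) ^ r * suc t ^ (s * s * k) * u ^ (t * (k * s)) ≤ suc u ^ (t * (k * s)) →
    HasSquare P Q n
  square-of-order s₂ t ρ {{t≢0}} r≤m Oₛ Oₖ Oₘ P Q p q u {{Q≢0}} {{q≢0}} {{u≢0}} bound linear losses = build many-transversals
    where
    open Construction s₂ t r≤m Oₛ Oₖ Oₘ (latinWithTransversal ρ) using (m′; A; ManyTransversalsOfOrder; many-transversals)
    open BalancedWords.Arrangements (BalancedWords.arrangements Oₛ t) using (W; W-bound)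
    s k m r : ℕ
    s = suc (suc s₂)
    k = suc (suc s)
    m = s * t
    r = 4 + ρ
    n≡ : ∀ k s t → k * (s * t) + r ≡ t * (k * s) + r
    n≡ k s t = cong (_+ r) (regroup k s t)
      where
      regroup : ∀ k s t → k * (s * t) ≡ t * (k * s)
      regroup = solve-∀
    build : ManyTransversalsOfOrder → HasSquare P Q (k * m + r)
    build (L , latin , N , count , transversals) = L , latin , N ,
      combine-bounds P Q p q u (k * m + r) (t * (k * s)) r (suc t ^ (s * s * k)) (s * (s₂ * t)) N
        {{u≢0}} {{q≢0}} {{m^n≢0 (suc t) (s * s * k)}} {{Q≢0}} (n≡ k s t)
        (counting s t m m′ k (s₂ * t) A W N p q (factorial-quotient t m′) refl refl count W-bound
          (FactorialBound.factorial-bound p q bound m) {{m*n≢0 s t {{_}} {{t≢0}}}})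
        linear losses , transversals
      where open Counting using (counting)

  -- Of the tB factors 1 + 1/u the first t already pay for both polynomial losses; the others are
  -- only bounded below by 1.
  bounded-losses : ∀ {C R e u t B x r} .{{_ : NonZero C}} .{{_ : NonZero B}} → x ≤ C * t → r ≤ R →
    (C * suc t) ^ (R + e) * u ^ t ≤ suc u ^ t → x ^ r * suc t ^ e * u ^ (t * B) ≤ suc u ^ (t * B)
  bounded-losses {C} {R} {e} {u} {t} {suc B} {x} {r} x≤ r≤R growth = begin
    x ^ r * suc t ^ e * u ^ (t * suc B)       ≤⟨ *-monoˡ-≤ (u ^ (t * suc B)) (*-mono-≤ x^r≤ (^-monoˡ-≤ e (m≤n*m (suc t) C))) ⟩
    K ^ R * K ^ e * u ^ (t * suc B)           ≡⟨ cong₂ _*_ (sym (^-distribˡ-+-* K R e)) (split u) ⟩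
    K ^ (R + e) * (u ^ t * u ^ d)             ≡⟨ *-assoc (K ^ (R + e)) (u ^ t) (u ^ d) ⟨
    K ^ (R + e) * u ^ t * u ^ d               ≤⟨ *-mono-≤ growth (^-monoˡ-≤ d (n≤1+n u)) ⟩
    suc u ^ t * suc u ^ d                     ≡⟨ split (suc u) ⟨
    suc u ^ (t * suc B)                       ∎
    where
    open ≤-Reasoning
    K d : ℕ
    K = C * suc t
    d = t * B
    split : ∀ u → u ^ (t * suc B) ≡ u ^ t * u ^ d
    split u = trans (cong (u ^_) (*-suc t B)) (^-distribˡ-+-* u t d)
    x^r≤ : x ^ r ≤ K ^ R
    x^r≤ = ≤-trans (^-monoˡ-≤ r (≤-trans x≤ (*-monoʳ-≤ C (n≤1+n t)))) (^-monoʳ-≤ K {{m*n≢0 C (suc t)}} r≤R)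

  -- The same u bounds n / m and sets the gap factor 1 + 1/u. The strict inequality of integers
  -- gives pQ ≥ Pq + 1, and this relative surplus pays for replacing u + 1 by s₂.
  linear-bound : ∀ {P Q p q s₂ s u t n} → n ≤ u * (s * t) → P * q < p * Q → P * q * suc u ≤ suc (P * q) * s₂ →
    P * n * q * suc u ≤ u * (Q * (p * (s * (s₂ * t))))
  linear-bound {P} {Q} {p} {q} {s₂} {s} {u} {t} {n} n≤ gap ratio = begin
    P * n * q * suc u                       ≤⟨ *-monoˡ-≤ (suc u) (*-monoˡ-≤ q (*-monoʳ-≤ P n≤)) ⟩
    P * (u * (s * t)) * q * suc u           ≡⟨ regroup₁ P q u s t ⟩
    u * (P * q * suc u * (s * t))           ≤⟨ *-monoʳ-≤ u (*-monoˡ-≤ (s * t) (≤-trans ratio (*-monoˡ-≤ s₂ gap))) ⟩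
    u * (p * Q * s₂ * (s * t))              ≡⟨ regroup₂ u p Q s₂ s t ⟩
    u * (Q * (p * (s * (s₂ * t))))          ∎
    where
    open ≤-Reasoning
    regroup₁ : ∀ P q u s t → P * (u * (s * t)) * q * suc u ≡ u * (P * q * suc u * (s * t))
    regroup₁ = solve-∀
    regroup₂ : ∀ u p Q s₂ s t → u * (p * Q * s₂ * (s * t)) ≡ u * (Q * (p * (s * (s₂ * t))))
    regroup₂ = solve-∀

  module Assembly (P Q p q h : ℕ) .{{P≢0 : NonZero P}} .{{Q≢0 : NonZero Q}} .{{q≢0 : NonZero q}}
    (gap : P * q < p * Q) (bound : ∀ N → p * e²-scaled N ≤ q * N !) (h≡ : h ≡ 3 * (P * q)) where

    -- With u = s₂ + 5 the condition `ratio` amounts to 6Pq ≤ s₂. The value 2h + 1 = 6Pq + 1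
    -- satisfies it and is odd, which makes s and k odd. Here u = k + 1 bounds n / m, `R` bounds r,
    -- and Ct bounds Pn.
    s₂ s k B R e u C : ℕ
    s₂ = h + suc h
    s  = suc (suc s₂)
    k  = suc (suc s)
    B  = k * s
    R  = 4 + 2 * B
    e  = s * s * k
    u  = suc k
    C  = P * (u * s)

    private instance
      C≢0 : NonZero C
      C≢0 = m*n≢0 P (u * s)

    open Growth C (R + e) u using (t₁; growth)

    threshold : ℕ
    threshold = t₁ + R

    k-odd : ∀ h → 4 + (h + suc h) ≡ suc (suc (suc h) + suc (suc h))
    k-odd = solve-∀

    m-odd : ∀ h τ → (2 + (h + suc h)) * suc (τ + τ) ≡
      suc ((suc h + τ + 2 * (suc h * τ)) + (suc h + τ + 2 * (suc h * τ)))
    m-odd = solve-∀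

    -- s is chosen to make this hold.
    ratio : P * q * suc u ≤ suc (P * q) * s₂
    ratio = ≤-trans (m≤m+n (P * q * suc u) 1)
      (≤-reflexive (subst (λ h → P * q * (6 + (h + suc h)) + 1 ≡ suc (P * q) * (h + suc h)) (sym h≡) (identity (P * q))))
      where
      identity : ∀ X → X * (6 + (3 * X + suc (3 * X))) + 1 ≡ suc X * (3 * X + suc (3 * X))
      identity = solve-∀

    hasSquare : ∀ τ t ρ .{{_ : NonZero t}} → t ≡ suc (τ + τ) → threshold ≤ t → ρ ≤ 2 * B → HasSquare P Q (k * (s * t) + (4 + ρ))
    hasSquare τ t ρ t≡ threshold≤t ρ≤2B =
      square-of-order s₂ t ρ r≤m (orthogonalPair (suc h) refl) (orthogonalPair (suc (suc h)) (k-odd h))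
        (orthogonalPair (suc h + τ + 2 * (suc h * τ)) (trans (cong (s *_) t≡) (m-odd h τ))) P Q p q u bound
        (linear-bound {P} {Q} {p} {q} {s₂} {s} {u} {t} n≤um gap ratio)
        (bounded-losses {C} {R} {e} {u} {t} {B} Pn≤Ct r≤R (growth t (≤-trans (m≤m+n t₁ R) threshold≤t)))
      where
      r≤R : 4 + ρ ≤ R
      r≤R = +-monoʳ-≤ 4 ρ≤2B
      r≤m : 4 + ρ ≤ s * t
      r≤m = ≤-trans r≤R (≤-trans (m≤n+m R t₁) (≤-trans threshold≤t (m≤m+n t (suc s₂ * t))))
      n≤um : k * (s * t) + (4 + ρ) ≤ u * (s * t)
      n≤um = ≤-trans (+-monoʳ-≤ (k * (s * t)) r≤m) (≤-reflexive (+-comm (k * (s * t)) (s * t)))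
      Pn≤Ct : P * (k * (s * t) + (4 + ρ)) ≤ C * t
      Pn≤Ct = ≤-trans (*-monoʳ-≤ P n≤um) (≤-reflexive (regroup P u s t))
        where
        regroup : ∀ P u s t → P * (u * (s * t)) ≡ P * (u * s) * t
        regroup = solve-∀

    -- With t = 2τ + 1, an order n = Bt + 4 + ρ equals B + 4 plus 2Bτ + ρ. Division by 2B yields τ
    -- and ρ < 2B, and the second summand makes τ reach `threshold`.
    N₀ : ℕ
    N₀ = (B + 4) + threshold * (2 * B)

    eventually : ∀ n → n ≥ N₀ → HasSquare P Q n
    eventually n n≥N₀ = subst (HasSquare P Q) n≡ (hasSquare τ (suc (τ + τ)) ρ refl threshold≤t (<⇒≤ (m%n<n x (2 * B))))
      where
      x τ ρ : ℕ
      x = n ∸ (B + 4)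
      τ = x / (2 * B)
      ρ = x % (2 * B)
      threshold≤τ : threshold ≤ τ
      threshold≤τ = subst (_≤ τ) (m*n/n≡m threshold (2 * B)) (/-monoˡ-≤ (2 * B)
        (subst (_≤ x) (m+n∸m≡n (B + 4) (threshold * (2 * B))) (∸-monoˡ-≤ (B + 4) n≥N₀)))
      threshold≤t : threshold ≤ suc (τ + τ)
      threshold≤t = ≤-trans threshold≤τ (≤-trans (m≤m+n τ τ) (n≤1+n (τ + τ)))
      regroup : ∀ k s τ ρ → k * (s * suc (τ + τ)) + (4 + ρ) ≡ (k * s + 4) + (ρ + τ * (2 * (k * s)))
      regroup = solve-∀
      n≡ : k * (s * suc (τ + τ)) + (4 + ρ) ≡ n
      n≡ = trans (regroup k s τ ρ) (trans (cong ((B + 4) +_) (sym (m≡m%n+[m/n]*n x (2 * B))))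
        (m+[n∸m]≡n (≤-trans (m≤m+n (B + 4) _) n≥N₀)))

  opaque
    eventually-hasSquare : ∀ P Q .{{_ : NonZero P}} .{{_ : NonZero Q}} → (∀ k → P * e²-scaled k ≤ Q * k !) →
      Σ ℕ λ N₀ → ∀ n → n ≥ N₀ → HasSquare P Q n
    eventually-hasSquare P Q bound with Gap.improved P Q bound
    ... | p , q , gap , bound′ = N₀ , eventually
      where
      pQ≢0 : NonZero (p * Q)
      pQ≢0 = >-nonZero (≤-trans (s≤s z≤n) gap)
      instance
        q≢0 : NonZero q
        q≢0 = >-nonZero (≤-trans (≤-trans (>-nonZero⁻¹ p {{m*n≢0⇒m≢0 p {Q} {{pQ≢0}}}}) (≤-reflexive (sym (*-identityʳ p))))
          (≤-trans (bound′ 0) (≤-reflexive (*-identityʳ q))))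
      open Assembly P Q p q (3 * (P * q)) gap bound′ refl

-- Passage between rationals and integers

open import Data.Nat as ℕ using (_!)
open import Data.Nat.Properties as ℕₚ using (m^n≢0)
open import Data.Integer as ℤ using (+_; +[1+_])
open import Data.Integer.Properties as ℤₚ using (pos-*)
open import Data.Rational as ℚ using (ℚ; mkℚ; _≤_; _*_; _+_; 1ℚ; Positive; NonNegative; toℚᵘ; positive; nonNegative)
open import Data.Rational.Properties as ℚₚ
  using (toℚᵘ-injective; toℚᵘ-fromℚᵘ; toℚᵘ-homo-+; toℚᵘ-homo-*; toℚᵘ-mono-≤; toℚᵘ-cancel-≤)
open import Data.Rational.Unnormalised as ℚᵘ using (mkℚᵘ; *≡*; *≤*; _≃_)
open import Data.Rational.Unnormalised.Properties as ℚᵘₚ using ()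
open import Algebra.Bundles using (CommutativeMonoid)
open import Algebra.Properties.CommutativeSemigroup (CommutativeMonoid.commutativeSemigroup ℚₚ.*-1-commutativeMonoid)
  using (interchange; xy∙z≈xz∙y)
open Series using (e²-scaled)
open Asymptotics using (HasSquare; eventually-hasSquare)

toℚᵘ-ℕ→ℚ : ∀ n → toℚᵘ (ℕ→ℚ n) ≃ mkℚᵘ (+ n) 0
toℚᵘ-ℕ→ℚ n = toℚᵘ-fromℚᵘ (mkℚᵘ (+ n) 0)

ℕ→ℚ-+ : ∀ a b → ℕ→ℚ (a ℕ.+ b) ≡ ℕ→ℚ a + ℕ→ℚ b
ℕ→ℚ-+ a b = toℚᵘ-injective (begin
  toℚᵘ (ℕ→ℚ (a ℕ.+ b))                 ≈⟨ toℚᵘ-ℕ→ℚ (a ℕ.+ b) ⟩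
  mkℚᵘ (+ (a ℕ.+ b)) 0                 ≈⟨ *≡* (cong (ℤ._* + 1) (sym (cong₂ ℤ._+_ (ℤₚ.*-identityʳ (+ a)) (ℤₚ.*-identityʳ (+ b))))) ⟩
  mkℚᵘ (+ a) 0 ℚᵘ.+ mkℚᵘ (+ b) 0       ≈⟨ ℚᵘₚ.+-cong (toℚᵘ-ℕ→ℚ a) (toℚᵘ-ℕ→ℚ b) ⟨
  toℚᵘ (ℕ→ℚ a) ℚᵘ.+ toℚᵘ (ℕ→ℚ b)       ≈⟨ toℚᵘ-homo-+ (ℕ→ℚ a) (ℕ→ℚ b) ⟨
  toℚᵘ (ℕ→ℚ a + ℕ→ℚ b)                 ∎)
  where open import Relation.Binary.Reasoning.Setoid ℚᵘₚ.≃-setoid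

ℕ→ℚ-* : ∀ a b → ℕ→ℚ (a ℕ.* b) ≡ ℕ→ℚ a * ℕ→ℚ b
ℕ→ℚ-* a b = toℚᵘ-injective (begin
  toℚᵘ (ℕ→ℚ (a ℕ.* b))                 ≈⟨ toℚᵘ-ℕ→ℚ (a ℕ.* b) ⟩
  mkℚᵘ (+ (a ℕ.* b)) 0                 ≈⟨ *≡* (cong (ℤ._* + 1) (pos-* a b)) ⟩
  mkℚᵘ (+ a) 0 ℚᵘ.* mkℚᵘ (+ b) 0       ≈⟨ ℚᵘₚ.*-cong (toℚᵘ-ℕ→ℚ a) (toℚᵘ-ℕ→ℚ b) ⟨
  toℚᵘ (ℕ→ℚ a) ℚᵘ.* toℚᵘ (ℕ→ℚ b)       ≈⟨ toℚᵘ-homo-* (ℕ→ℚ a) (ℕ→ℚ b) ⟨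
  toℚᵘ (ℕ→ℚ a * ℕ→ℚ b)                 ∎)
  where open import Relation.Binary.Reasoning.Setoid ℚᵘₚ.≃-setoid

ℕ→ℚ-mono-≤ : ∀ {a b} → a ℕ.≤ b → ℕ→ℚ a ≤ ℕ→ℚ b
ℕ→ℚ-mono-≤ {a} {b} a≤b = toℚᵘ-cancel-≤ (begin
  toℚᵘ (ℕ→ℚ a)     ≃⟨ toℚᵘ-ℕ→ℚ a ⟩
  mkℚᵘ (+ a) 0     ≤⟨ *≤* (ℤₚ.*-monoʳ-≤-nonNeg (+ 1) (ℤ.+≤+ a≤b)) ⟩
  mkℚᵘ (+ b) 0     ≃⟨ toℚᵘ-ℕ→ℚ b ⟨
  toℚᵘ (ℕ→ℚ b)     ∎)
  where open ℚᵘₚ.≤-Reasoning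

ℕ→ℚ-cancel-≤ : ∀ {a b} → ℕ→ℚ a ≤ ℕ→ℚ b → a ℕ.≤ b
ℕ→ℚ-cancel-≤ {a} {b} a≤b with mkℚᵘ-≤
  where
  open ℚᵘₚ.≤-Reasoning
  mkℚᵘ-≤ : mkℚᵘ (+ a) 0 ℚᵘ.≤ mkℚᵘ (+ b) 0
  mkℚᵘ-≤ = begin
    mkℚᵘ (+ a) 0     ≃⟨ toℚᵘ-ℕ→ℚ a ⟨
    toℚᵘ (ℕ→ℚ a)     ≤⟨ toℚᵘ-mono-≤ a≤b ⟩
    toℚᵘ (ℕ→ℚ b)     ≃⟨ toℚᵘ-ℕ→ℚ b ⟩
    mkℚᵘ (+ b) 0     ∎
... | *≤* a≤b′ = ℤₚ.drop‿+≤+ (subst₂ ℤ._≤_ (ℤₚ.*-identityʳ (+ a)) (ℤₚ.*-identityʳ (+ b)) a≤b′)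

ℕ→ℚ-positive : ∀ n .{{_ : ℕ.NonZero n}} → Positive (ℕ→ℚ n)
ℕ→ℚ-positive (suc n) = positive (ℚₚ.<-≤-trans (ℚₚ.positive⁻¹ 1ℚ) (ℕ→ℚ-mono-≤ {1} {suc n} (ℕ.s≤s ℕ.z≤n)))

ℕ→ℚ-nonNegative : ∀ n → NonNegative (ℕ→ℚ n)
ℕ→ℚ-nonNegative n = nonNegative (ℕ→ℚ-mono-≤ {0} {n} ℕ.z≤n)

fraction-* : ∀ a d → (+ a ℚ./ suc d) * ℕ→ℚ (suc d) ≡ ℕ→ℚ a
fraction-* a d = toℚᵘ-injective (begin
  toℚᵘ ((+ a ℚ./ suc d) * ℕ→ℚ (suc d))                ≈⟨ toℚᵘ-homo-* (+ a ℚ./ suc d) (ℕ→ℚ (suc d)) ⟩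
  toℚᵘ (+ a ℚ./ suc d) ℚᵘ.* toℚᵘ (ℕ→ℚ (suc d))        ≈⟨ ℚᵘₚ.*-cong (toℚᵘ-fromℚᵘ (mkℚᵘ (+ a) d)) (toℚᵘ-ℕ→ℚ (suc d)) ⟩
  mkℚᵘ (+ a) d ℚᵘ.* mkℚᵘ (+ suc d) 0                  ≈⟨ *≡* (trans (ℤₚ.*-identityʳ _) (cong (λ z → + a ℤ.* + z) (sym (ℕₚ.*-identityʳ (suc d))))) ⟩
  mkℚᵘ (+ a) 0                                        ≈⟨ toℚᵘ-ℕ→ℚ a ⟨
  toℚᵘ (ℕ→ℚ a)                                        ∎)
  where open import Relation.Binary.Reasoning.Setoid ℚᵘₚ.≃-setoid

e²-term-! : ∀ k → e²-term k * ℕ→ℚ (k !) ≡ ℕ→ℚ (2 ℕ.^ k)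
e²-term-! zero    = refl
e²-term-! (suc k) = begin
  e²-term k * (+ 2 ℚ./ suc k) * ℕ→ℚ (suc k ℕ.* k !)          ≡⟨ cong (e²-term k * (+ 2 ℚ./ suc k) *_) (ℕ→ℚ-* (suc k) (k !)) ⟩
  e²-term k * (+ 2 ℚ./ suc k) * (ℕ→ℚ (suc k) * ℕ→ℚ (k !))    ≡⟨ regroup (e²-term k) (+ 2 ℚ./ suc k) (ℕ→ℚ (suc k)) (ℕ→ℚ (k !)) ⟩
  (+ 2 ℚ./ suc k) * ℕ→ℚ (suc k) * (e²-term k * ℕ→ℚ (k !))    ≡⟨ cong₂ _*_ (fraction-* 2 k) (e²-term-! k) ⟩
  ℕ→ℚ 2 * ℕ→ℚ (2 ℕ.^ k)                                      ≡⟨ ℕ→ℚ-* 2 (2 ℕ.^ k) ⟨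
  ℕ→ℚ (2 ℕ.* 2 ℕ.^ k)                                        ∎
  where
  open ≡-Reasoning
  regroup : ∀ a b c d → a * b * (c * d) ≡ b * c * (a * d)
  regroup a b c d = trans (cong (_* (c * d)) (ℚₚ.*-comm a b)) (interchange b a c d)

e²-partial-! : ∀ k → e²-partial k * ℕ→ℚ (k !) ≡ ℕ→ℚ (e²-scaled k)
e²-partial-! zero    = refl
e²-partial-! (suc k) = begin
  (e²-partial k + e²-term (suc k)) * ℕ→ℚ (suc k !)                        ≡⟨ ℚₚ.*-distribʳ-+ (ℕ→ℚ (suc k !)) (e²-partial k) (e²-term (suc k)) ⟩
  e²-partial k * ℕ→ℚ (suc k !) + e²-term (suc k) * ℕ→ℚ (suc k !)          ≡⟨ cong₂ _+_ partial (e²-term-! (suc k)) ⟩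
  ℕ→ℚ (suc k ℕ.* e²-scaled k) + ℕ→ℚ (2 ℕ.^ suc k)                         ≡⟨ ℕ→ℚ-+ (suc k ℕ.* e²-scaled k) (2 ℕ.^ suc k) ⟨
  ℕ→ℚ (suc k ℕ.* e²-scaled k ℕ.+ 2 ℕ.^ suc k)                             ∎
  where
  open ≡-Reasoning
  partial : e²-partial k * ℕ→ℚ (suc k !) ≡ ℕ→ℚ (suc k ℕ.* e²-scaled k)
  partial = begin
    e²-partial k * ℕ→ℚ (suc k ℕ.* k !)         ≡⟨ cong (λ z → e²-partial k * ℕ→ℚ z) (ℕₚ.*-comm (suc k) (k !)) ⟩
    e²-partial k * ℕ→ℚ (k ! ℕ.* suc k)         ≡⟨ cong (e²-partial k *_) (ℕ→ℚ-* (k !) (suc k)) ⟩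
    e²-partial k * (ℕ→ℚ (k !) * ℕ→ℚ (suc k))   ≡⟨ ℚₚ.*-assoc (e²-partial k) (ℕ→ℚ (k !)) (ℕ→ℚ (suc k)) ⟨
    e²-partial k * ℕ→ℚ (k !) * ℕ→ℚ (suc k)     ≡⟨ cong (_* ℕ→ℚ (suc k)) (e²-partial-! k) ⟩
    ℕ→ℚ (e²-scaled k) * ℕ→ℚ (suc k)            ≡⟨ ℕ→ℚ-* (e²-scaled k) (suc k) ⟨
    ℕ→ℚ (e²-scaled k ℕ.* suc k)                ≡⟨ cong ℕ→ℚ (ℕₚ.*-comm (e²-scaled k) (suc k)) ⟩
    ℕ→ℚ (suc k ℕ.* e²-scaled k)                ∎

-- Scaling by Q k! gives the integral form of the hypothesis, on which the divisibility argument
-- relies.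
clear-denominators : ∀ {c P Q} → c * ℕ→ℚ Q ≡ ℕ→ℚ P → ((k : ℕ) → c * e²-partial k ≤ 1ℚ) →
  ∀ k → P ℕ.* e²-scaled k ℕ.≤ Q ℕ.* k !
clear-denominators {c} {P} {Q} cQ≡P bound k = ℕ→ℚ-cancel-≤ (begin
  ℕ→ℚ (P ℕ.* e²-scaled k)                               ≡⟨ ℕ→ℚ-* P (e²-scaled k) ⟩
  ℕ→ℚ P * ℕ→ℚ (e²-scaled k)                             ≡⟨ cong₂ _*_ cQ≡P (e²-partial-! k) ⟨
  c * ℕ→ℚ Q * (e²-partial k * ℕ→ℚ (k !))                ≡⟨ interchange c (ℕ→ℚ Q) (e²-partial k) (ℕ→ℚ (k !)) ⟩
  c * e²-partial k * (ℕ→ℚ Q * ℕ→ℚ (k !))                ≡⟨ cong (c * e²-partial k *_) (ℕ→ℚ-* Q (k !)) ⟨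
  c * e²-partial k * ℕ→ℚ (Q ℕ.* k !)                    ≤⟨ ℚₚ.*-monoʳ-≤-nonNeg (ℕ→ℚ (Q ℕ.* k !)) {{ℕ→ℚ-nonNegative (Q ℕ.* k !)}} (bound k) ⟩
  1ℚ * ℕ→ℚ (Q ℕ.* k !)                                  ≡⟨ ℚₚ.*-identityˡ (ℕ→ℚ (Q ℕ.* k !)) ⟩
  ℕ→ℚ (Q ℕ.* k !)                                       ∎)
  where
  open ℚₚ.≤-Reasoning

ℕ→ℚ-^ : ∀ {x a} b n → x * ℕ→ℚ b ≡ ℕ→ℚ a → x ^ℚ n * ℕ→ℚ (b ℕ.^ n) ≡ ℕ→ℚ (a ℕ.^ n)
ℕ→ℚ-^ b zero    eq = refl
ℕ→ℚ-^ {x} {a} b (suc n) eq = begin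
  x * x ^ℚ n * ℕ→ℚ (b ℕ.* b ℕ.^ n)            ≡⟨ cong (x * x ^ℚ n *_) (ℕ→ℚ-* b (b ℕ.^ n)) ⟩
  x * x ^ℚ n * (ℕ→ℚ b * ℕ→ℚ (b ℕ.^ n))        ≡⟨ interchange x (x ^ℚ n) (ℕ→ℚ b) (ℕ→ℚ (b ℕ.^ n)) ⟩
  x * ℕ→ℚ b * (x ^ℚ n * ℕ→ℚ (b ℕ.^ n))        ≡⟨ cong₂ _*_ eq (ℕ→ℚ-^ b n eq) ⟩
  ℕ→ℚ a * ℕ→ℚ (a ℕ.^ n)                       ≡⟨ ℕ→ℚ-* a (a ℕ.^ n) ⟨
  ℕ→ℚ (a ℕ.* a ℕ.^ n)                         ∎
  where
  open ≡-Reasoning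

divide-power : ∀ {c P Q} .{{_ : ℕ.NonZero Q}} → c * ℕ→ℚ Q ≡ ℕ→ℚ P → ∀ n N → (P ℕ.* n) ℕ.^ n ℕ.≤ Q ℕ.^ n ℕ.* N →
  (c * ℕ→ℚ n) ^ℚ n ≤ ℕ→ℚ N
divide-power {c} {P} {Q} cQ≡P n N Pn≤ = ℚₚ.*-cancelʳ-≤-pos (ℕ→ℚ (Q ℕ.^ n)) {{ℕ→ℚ-positive (Q ℕ.^ n) {{m^n≢0 Q n}}}} (begin
  (c * ℕ→ℚ n) ^ℚ n * ℕ→ℚ (Q ℕ.^ n)    ≡⟨ ℕ→ℚ-^ {a = P ℕ.* n} Q n base ⟩
  ℕ→ℚ ((P ℕ.* n) ℕ.^ n)               ≤⟨ ℕ→ℚ-mono-≤ Pn≤ ⟩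
  ℕ→ℚ (Q ℕ.^ n ℕ.* N)                 ≡⟨ trans (cong ℕ→ℚ (ℕₚ.*-comm (Q ℕ.^ n) N)) (ℕ→ℚ-* N (Q ℕ.^ n)) ⟩
  ℕ→ℚ N * ℕ→ℚ (Q ℕ.^ n)               ∎)
  where
  open ℚₚ.≤-Reasoning
  base : c * ℕ→ℚ n * ℕ→ℚ Q ≡ ℕ→ℚ (P ℕ.* n)
  base = trans (xy∙z≈xz∙y c (ℕ→ℚ n) (ℕ→ℚ Q)) (trans (cong (_* ℕ→ℚ n) cQ≡P) (sym (ℕ→ℚ-* P n)))

as-fraction : ∀ c → Positive c → ∃ λ P → ∃ λ Q → c * ℕ→ℚ (suc Q) ≡ ℕ→ℚ (suc P)
as-fraction c@(mkℚ +[1+ P ] Q _) _ = P , Q ,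
  trans (cong (_* ℕ→ℚ (suc Q)) (sym (ℚₚ.↥p/↧p≡p c))) (fraction-* (suc P) Q)

ManyTransversalsEventually : ℚ → Set
ManyTransversalsEventually c = Σ ℕ λ N → (n : ℕ) → n ≥ N →
  Σ (Fin n → Fin n → Fin n) λ L → IsLatinSquare n L ×
  Σ ℕ λ m → ((c * ℕ→ℚ n) ^ℚ n ≤ ℕ→ℚ m) × HasAtLeastTransversals n L m

theorem1p3 : (c : ℚ) → Positive c → ((k : ℕ) → c * e²-partial k ≤ 1ℚ) →
    Σ ℕ λ N → (n : ℕ) → n ≥ N →
    Σ (Fin n → Fin n → Fin n) λ L → IsLatinSquare n L ×
    Σ ℕ λ m → ((c * ℕ→ℚ n) ^ℚ n ≤ ℕ→ℚ m) × HasAtLeastTransversals n L m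
theorem1p3 c c>0 bound = from-fraction (as-fraction c c>0)
  where
  from-squares : ∀ P Q → c * ℕ→ℚ (suc Q) ≡ ℕ→ℚ (suc P) → (∃ λ N → ∀ n → n ≥ N → HasSquare (suc P) (suc Q) n) → ManyTransversalsEventually c
  from-squares P Q cQ≡P (N , squares) = N , λ n n≥N →
    let L , latin , m , large , transversals = squares n n≥N
    in  L , latin , m , divide-power {c} {suc P} {suc Q} cQ≡P n m large , transversals
  from-fraction : (∃ λ P → ∃ λ Q → c * ℕ→ℚ (suc Q) ≡ ℕ→ℚ (suc P)) → ManyTransversalsEventually c
  from-fraction (P , Q , cQ≡P) = from-squares P Q cQ≡P
    (eventually-hasSquare (suc P) (suc Q) (clear-denominators {c} {suc P} {suc Q} cQ≡P bound))
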